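{- Let $\widetilde{s}_n$ be the number of unlabeled split graphs on $n$ vertices and let $\widetilde{b}_n$ be the number of unlabeled bicolored graphs on $n$ vertices. Then $\widetilde{s}_n\sim\widetilde{b}_n$, i.e. $\lim_{n\to\infty}\widetilde{s}_n/\widetilde{b}_n=1$.
   Context: Graphs are finite and simple. A split graph is a graph whose vertices can be partitioned into two (possibly empty) sets $K$ and $S$ such that $K$ is a clique and $S$ is a stable (independent) set. A bicolored graph is a graph in which each vertex is colored green or red such that no two adjacent vertices have the same color; the colors are not interchangeable, and isomorphisms of bicolored graphs are the graph isomorphisms that preserve color. Unlabeled split graphs are isomorphism classes of split graphs; unlabeled bicolored graphs are isomorphism classes of bicolored graphs under color-preserving isomorphism. -}

module Defs where

open import Data.Bool.Base using (Bool; true; false)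
import Data.Bool.Properties as Bool
open import Data.Fin.Base using (Fin; zero; suc)
open import Data.Fin.Permutation as Perm
  using (Permutation′; permutation; _⟨$⟩ʳ_; _⟨$⟩ˡ_; inverseˡ; inverseʳ)
open import Data.Fin.Properties as Fin using (all?)
open import Data.Fin.Subset using (Subset; _∈_; ∁)
open import Data.Fin.Subset.Properties using (_∈?_; anySubset?)
open import Data.Integer.Base using (+_)
open import Data.List.Base
  using (List; []; _∷_; allFin; map; length; lookup; concatMap; cartesianProduct; cartesianProductWith; deduplicate)
open import Data.List.Membership.Propositional.Properties using (∈-allFin; ∈-lookup)
import Data.List.Relation.Unary.All as All
open import Data.List.Relation.Unary.AllPairs using (AllPairs; []; _∷_)
open import Data.List.Relation.Unary.Any as Any using (Any; here; there; any?)
import Data.List.Relation.Unary.Any.Properties as Any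
open import Data.List.Relation.Unary.Enumerates.Setoid using (IsEnumeration)
open import Data.List.Relation.Unary.Enumerates.Setoid.Properties
  using (deduplicate⁺; lookup-surjective)
open import Data.List.Relation.Unary.Unique.DecSetoid.Properties using (deduplicate-!)
open import Data.Nat.Base using (ℕ; zero; suc; _≤_; NonZero)
open import Data.Product.Base using (Σ; ∃; _×_; _,_; proj₁; proj₂)
open import Data.Rational.Base as ℚ using (ℚ; 0ℚ; 1ℚ; _/_; _-_; ∣_∣)
open import Function.Base using (_∘_)
open import Function.Bundles using (Bijection)
open import Level using (0ℓ; _⊔_)
open import Relation.Binary.Bundles using (Setoid; DecSetoid)
import Relation.Binary.Construct.On as On
open import Relation.Binary.Definitions using (Decidable)
open import Relation.Binary.PropositionalEquality
  using (_≡_; _≢_; refl; sym; trans; cong; cong₂; setoid)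
open import Relation.Nullary using (Dec; yes; no; ¬_; contradiction)
open import Relation.Nullary.Decidable using (map′; _×-dec_; _→-dec_; ¬?)

record Graph (n : ℕ) : Set where
  field
    adj      : Fin n → Fin n → Bool
    adj-sym  : ∀ u v → adj u v ≡ adj v u
    loopless : ∀ v → adj v v ≡ false

  Adj : Fin n → Fin n → Set
  Adj u v = adj u v ≡ true

open Graph public

IsClique : ∀ {n} → Graph n → Subset n → Set
IsClique G K = ∀ u v → u ∈ K → v ∈ K → u ≢ v → Adj G u v

IsStable : ∀ {n} → Graph n → Subset n → Set
IsStable G S = ∀ u v → u ∈ S → v ∈ S → ¬ Adj G u v

IsSplit : ∀ {n} → Graph n → Set
IsSplit G = ∃ λ K → IsClique G K × IsStable G (∁ K)

SplitGraph : ℕ → Set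
SplitGraph n = Σ (Graph n) IsSplit

data Color : Set where
  green red : Color

record BicoloredGraph (n : ℕ) : Set where
  field
    graph  : Graph n
    color  : Fin n → Color
    proper : ∀ u v → Adj graph u v → color u ≢ color v

open BicoloredGraph public

PreservesAdj : ∀ {n} → Graph n → Graph n → Permutation′ n → Set
PreservesAdj G H π = ∀ u v → adj G u v ≡ adj H (π ⟨$⟩ʳ u) (π ⟨$⟩ʳ v)

PreservesColor : ∀ {n} → BicoloredGraph n → BicoloredGraph n → Permutation′ n → Set
PreservesColor B C π = ∀ v → color B v ≡ color C (π ⟨$⟩ʳ v)

infix 4 _≅_ _≅ᵇ_

_≅_ : ∀ {n} → Graph n → Graph n → Set
G ≅ H = ∃ λ π → PreservesAdj G H π

_≅ᵇ_ : ∀ {n} → BicoloredGraph n → BicoloredGraph n → Set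
B ≅ᵇ C = ∃ λ π → PreservesAdj (graph B) (graph C) π × PreservesColor B C π

PreservesAdj-flip : ∀ {n} (G H : Graph n) π → PreservesAdj G H π → PreservesAdj H G (Perm.flip π)
PreservesAdj-flip G H π p u v = sym (trans (p _ _) (cong₂ (adj H) (inverseʳ π) (inverseʳ π)))

graphSetoid : ℕ → Setoid 0ℓ 0ℓ
graphSetoid n = record
  { Carrier = Graph n
  ; _≈_ = _≅_
  ; isEquivalence = record
    { refl  = Perm.id , λ _ _ → refl
    ; sym   = λ {G} {H} (π , p) → Perm.flip π , PreservesAdj-flip G H π p
    ; trans = λ (π , p) (ρ , q) → π Perm.∘ₚ ρ , λ u v → trans (p u v) (q _ _)
    }
  }

splitSetoid : ℕ → Setoid 0ℓ 0ℓ
splitSetoid n = On.setoid {B = SplitGraph n} (graphSetoid n) proj₁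

bicoloredSetoid : ℕ → Setoid 0ℓ 0ℓ
bicoloredSetoid n = record
  { Carrier = BicoloredGraph n
  ; _≈_ = _≅ᵇ_
  ; isEquivalence = record
    { refl  = Perm.id , (λ _ _ → refl) , λ _ → refl
    ; sym   = λ {B} {C} (π , p , c) → Perm.flip π
                , PreservesAdj-flip (graph B) (graph C) π p
                , λ v → sym (trans (c _) (cong (color C) (inverseʳ π)))
    ; trans = λ (π , p , c) (ρ , q , d) → π Perm.∘ₚ ρ
                , (λ u v → trans (p u v) (q _ _))
                , λ v → trans (c v) (d _)
    }
  }

-- A bijection of setoids out of Fin k is a complete irredundant system of
-- representatives, so this says that S has exactly k equivalence classes.
HasClasses : ∀ {a ℓ} → Setoid a ℓ → ℕ → Set (a ⊔ ℓ)
HasClasses S k = Bijection (setoid (Fin k)) S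

module _ {a ℓ} (S : Setoid a ℓ) where
  open Setoid S using (_≈_) renaming (sym to ≈-sym; reflexive to ≈-reflexive)

  lookup-injective : ∀ {xs} → AllPairs (λ x y → ¬ (x ≈ y)) xs →
                     ∀ i j → lookup xs i ≈ lookup xs j → i ≡ j
  lookup-injective (_ ∷ _)  zero    zero    _ = refl
  lookup-injective (x≉ ∷ _) zero    (suc j) e = contradiction e (All.lookup x≉ (∈-lookup j))
  lookup-injective (x≉ ∷ _) (suc i) zero    e = contradiction (≈-sym e) (All.lookup x≉ (∈-lookup i))
  lookup-injective (_ ∷ !s) (suc i) (suc j) e = cong suc (lookup-injective !s i j e)

  countClasses : Decidable _≈_ → ∀ xs → IsEnumeration S xs → ∃ (HasClasses S)
  countClasses _≈?_ xs enum = length reps , record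
    { to        = lookup reps
    ; cong      = ≈-reflexive ∘ cong (lookup reps)
    ; bijective = lookup-injective (deduplicate-! S? xs) _ _
                , lookup-surjective S (deduplicate⁺ S? enum)
    }
    where
    S? : DecSetoid a ℓ
    S? = record { isDecEquivalence = record { isEquivalence = Setoid.isEquivalence S ; _≟_ = _≈?_ } }
    reps = deduplicate _≈?_ xs

functions : ∀ {A : Set} → List A → ∀ n → List (Fin n → A)
functions xs zero    = (λ ()) ∷ []
functions xs (suc n) =
  cartesianProductWith (λ x f → λ { zero → x ; (suc i) → f i }) xs (functions xs n)

functions-complete : ∀ {A : Set} {R : A → A → Set} {xs} → (∀ a → Any (R a) xs) →
                     ∀ {n} (f : Fin n → A) → Any (λ g → ∀ i → R (f i) (g i)) (functions xs n)
functions-complete c {zero}  f = here λ ()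
functions-complete c {suc n} f =
  Any.cartesianProductWith⁺ _ (λ r s → λ { zero → r ; (suc i) → s i })
    (c (f zero)) (functions-complete c (f ∘ suc))

endos : ∀ n → List (Fin n → Fin n)
endos n = functions (allFin n) n

endos-complete : ∀ {n} (f : Fin n → Fin n) → Any (λ g → ∀ i → f i ≡ g i) (endos n)
endos-complete = functions-complete ∈-allFin

anyPermutation? : ∀ {n} {P : (Fin n → Fin n) → Set} →
                  (∀ {f g} → (∀ i → f i ≡ g i) → P f → P g) → (∀ f → Dec (P f)) →
                  Dec (∃ λ (π : Permutation′ n) → P (π ⟨$⟩ʳ_))
anyPermutation? {n} {P} resp P? = map′ to from (any? Q? (cartesianProduct (endos n) (endos n)))
  where
  Q : (Fin n → Fin n) × (Fin n → Fin n) → Set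
  Q (f , g) = (∀ i → f (g i) ≡ i) × (∀ i → g (f i) ≡ i) × P f

  Q? : ∀ fg → Dec (Q fg)
  Q? (f , g) = all? (λ i → f (g i) Fin.≟ i) ×-dec (all? (λ i → g (f i) Fin.≟ i) ×-dec P? f)

  to : Any Q (cartesianProduct (endos n) (endos n)) → ∃ λ (π : Permutation′ n) → P (π ⟨$⟩ʳ_)
  to q with Any.satisfied q
  ... | (f , g) , fg , gf , p = permutation f g fg gf , p

  from : (∃ λ (π : Permutation′ n) → P (π ⟨$⟩ʳ_)) → Any Q (cartesianProduct (endos n) (endos n))
  from (π , p) = Any.cartesianProductWith⁺ _,_
    (λ {f} {g} ef eg →
        (λ i → trans (sym (ef (g i))) (trans (cong (π ⟨$⟩ʳ_) (sym (eg i))) (inverseʳ π)))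
      , (λ i → trans (sym (eg (f i))) (trans (cong (π ⟨$⟩ˡ_) (sym (ef i))) (inverseˡ π)))
      , resp ef p)
    (endos-complete (π ⟨$⟩ʳ_)) (endos-complete (π ⟨$⟩ˡ_))

collect : ∀ {A : Set} {P : A → Set} → (∀ a → Dec (P a)) → List A → List (Σ A P)
collect {A} {P} P? = concatMap (λ a → select a (P? a))
  module Collect where
  select : ∀ a → Dec (P a) → List (Σ A P)
  select a (yes p) = (a , p) ∷ []
  select a (no _)  = []

collect-complete : ∀ {A : Set} {P : A → Set} (P? : ∀ a → Dec (P a)) {R : A → Set} {xs} →
                   (∀ {a} → R a → P a) → Any R xs → Any (R ∘ proj₁) (collect P? xs)
collect-complete {A} {P} P? {R} R⇒P = Any.concatMap⁺ _ ∘ Any.map (λ {a} r → pick (P? a) r)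
  where
  pick : ∀ {a} (d : Dec (P a)) → R a → Any (R ∘ proj₁) (Collect.select P? a d)
  pick (yes _) r = here r
  pick (no ¬p) r = contradiction (R⇒P r) ¬p

preservesAdj? : ∀ {n} (G H : Graph n) (f : Fin n → Fin n) →
                Dec (∀ u v → adj G u v ≡ adj H (f u) (f v))
preservesAdj? G H f = all? λ u → all? λ v → adj G u v Bool.≟ adj H (f u) (f v)

_≅?_ : ∀ {n} → Decidable (_≅_ {n})
G ≅? H = anyPermutation?
  (λ e p u v → trans (p u v) (cong₂ (adj H) (e u) (e v)))
  (preservesAdj? G H)

_≟ᶜ_ : Decidable {A = Color} _≡_
green ≟ᶜ green = yes refl
green ≟ᶜ red   = no λ ()
red   ≟ᶜ green = no λ ()
red   ≟ᶜ red   = yes refl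

_≅ᵇ?_ : ∀ {n} → Decidable (_≅ᵇ_ {n})
B ≅ᵇ? C = anyPermutation?
  (λ e (p , c) → (λ u v → trans (p u v) (cong₂ (adj (graph C)) (e u) (e v)))
               , (λ v → trans (c v) (cong (color C) (e v))))
  (λ f → preservesAdj? (graph B) (graph C) f ×-dec all? (λ v → color B v ≟ᶜ color C (f v)))

isClique? : ∀ {n} (G : Graph n) K → Dec (IsClique G K)
isClique? G K = all? λ u → all? λ v →
  (u ∈? K) →-dec ((v ∈? K) →-dec (¬? (u Fin.≟ v) →-dec (adj G u v Bool.≟ true)))

isStable? : ∀ {n} (G : Graph n) S → Dec (IsStable G S)
isStable? G S = all? λ u → all? λ v →
  (u ∈? S) →-dec ((v ∈? S) →-dec ¬? (adj G u v Bool.≟ true))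

isSplit? : ∀ {n} (G : Graph n) → Dec (IsSplit G)
isSplit? G = anySubset? λ K → isClique? G K ×-dec isStable? G (∁ K)

IsGraph : ∀ {n} → (Fin n → Fin n → Bool) → Set
IsGraph a = (∀ u v → a u v ≡ a v u) × (∀ v → a v v ≡ false)

isGraph? : ∀ {n} (a : Fin n → Fin n → Bool) → Dec (IsGraph a)
isGraph? a = all? (λ u → all? λ v → a u v Bool.≟ a v u) ×-dec all? (λ v → a v v Bool.≟ false)

toGraph : ∀ {n} → Σ (Fin n → Fin n → Bool) IsGraph → Graph n
toGraph (a , s , l) = record { adj = a ; adj-sym = s ; loopless = l }

SameAdj : ∀ {n} → Graph n → Graph n → Set
SameAdj G H = ∀ u v → adj G u v ≡ adj H u v

graphs : ∀ n → List (Graph n)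
graphs n = map toGraph (collect isGraph? (functions (functions (true ∷ false ∷ []) n) n))

graphs-complete : ∀ {n} (G : Graph n) → Any (SameAdj G) (graphs n)
graphs-complete G = Any.map⁺ (collect-complete isGraph?
  (λ e → (λ u v → trans (sym (e u v)) (trans (adj-sym G u v) (e v u)))
       , (λ v → trans (sym (e v v)) (loopless G v)))
  (functions-complete {R = λ f g → ∀ i → f i ≡ g i}
    (functions-complete {R = _≡_} λ { true → here refl ; false → there (here refl) })
    (adj G)))

sameAdj⇒split : ∀ {n} (G H : Graph n) → SameAdj G H → IsSplit G → IsSplit H
sameAdj⇒split _ _ e (K , c , s) = K
  , (λ u v u∈ v∈ u≢v → trans (sym (e u v)) (c u v u∈ v∈ u≢v))
  , (λ u v u∈ v∈ a → s u v u∈ v∈ (trans (e u v) a))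

splitGraphs-enum : ∀ n → IsEnumeration (splitSetoid n) (collect isSplit? (graphs n))
splitGraphs-enum n (G , split) =
  Any.map (λ { (_ , e) → Perm.id , e })
    (collect-complete isSplit? {R = λ H → IsSplit H × SameAdj G H} proj₁
      (Any.map (λ {H} e → sameAdj⇒split G H e split , e) (graphs-complete G)))

IsProper : ∀ {n} → Graph n × (Fin n → Color) → Set
IsProper (G , c) = ∀ u v → Adj G u v → c u ≢ c v

isProper? : ∀ {n} (Gc : Graph n × (Fin n → Color)) → Dec (IsProper Gc)
isProper? (G , c) = all? λ u → all? λ v → (adj G u v Bool.≟ true) →-dec ¬? (c u ≟ᶜ c v)

toBicolored : ∀ {n} → Σ (Graph n × (Fin n → Color)) IsProper → BicoloredGraph n
toBicolored ((G , c) , p) = record { graph = G ; color = c ; proper = p }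

bicoloredGraphs : ∀ n → List (BicoloredGraph n)
bicoloredGraphs n = map toBicolored
  (collect isProper? (cartesianProduct (graphs n) (functions (green ∷ red ∷ []) n)))

bicoloredGraphs-enum : ∀ n → IsEnumeration (bicoloredSetoid n) (bicoloredGraphs n)
bicoloredGraphs-enum n B = Any.map⁺ (Any.map (λ { (e , d) → Perm.id , e , d })
  (collect-complete isProper?
    {R = λ (H , c) → SameAdj (graph B) H × (∀ v → color B v ≡ c v)}
    (λ { (e , d) u v a eq → proper B u v (trans (e u v) a) (trans (d u) (trans eq (sym (d v)))) })
    (Any.cartesianProductWith⁺ _,_ _,_ (graphs-complete (graph B))
      (functions-complete {R = _≡_} (λ { green → here refl ; red → there (here refl) }) (color B)))))

-- The count k is determined by HasClasses, so hiding the search loses nothing;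
-- unfolding it is what makes conversion checking intractable.
abstract
  splitClasses : ∀ n → ∃ (HasClasses (splitSetoid n))
  splitClasses n = countClasses (splitSetoid n) (λ G H → proj₁ G ≅? proj₁ H) _ (splitGraphs-enum n)

  bicoloredClasses : ∀ n → ∃ (HasClasses (bicoloredSetoid n))
  bicoloredClasses n = countClasses (bicoloredSetoid n) _≅ᵇ?_ _ (bicoloredGraphs-enum n)

s̃ : ℕ → ℕ
s̃ n = proj₁ (splitClasses n)

b̃ : ℕ → ℕ
b̃ n = proj₁ (bicoloredClasses n)

inhabited⇒nonZero : ∀ {a ℓ} (S : Setoid a ℓ) → Setoid.Carrier S → ∀ {k} → HasClasses S k → NonZero k
inhabited⇒nonZero S x {zero}  bij with () ← proj₁ (Bijection.surjective bij x)
inhabited⇒nonZero S x {suc k} bij = _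

instance
  b̃-nonZero : ∀ {n} → NonZero (b̃ n)
  b̃-nonZero {n} = inhabited⇒nonZero (bicoloredSetoid n) edgeless (proj₂ (bicoloredClasses n))
    where
    edgeless : BicoloredGraph n
    edgeless = record
      { graph  = record { adj = λ _ _ → false ; adj-sym = λ _ _ → refl ; loopless = λ _ → refl }
      ; color  = λ _ → green
      ; proper = λ _ _ ()
      }

-- Restricting ε to the rationals changes nothing, as ℚ is dense in ℝ.
_⟶_ : (ℕ → ℚ) → ℚ → Set
a ⟶ L = ∀ ε → 0ℚ ℚ.< ε → ∃ λ N → ∀ n → N ≤ n → ∣ a n - L ∣ ℚ.< ε

infix 4 _⟶_ _∼_

_∼_ : (f g : ℕ → ℕ) .{{_ : ∀ {n} → NonZero (g n)}} → Set
f ∼ g = (λ n → + f n / g n) ⟶ 1ℚ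

module Submission where

import Algebra.Properties.Group as GroupProperties
open import Data.Bool.Base using (Bool; true; false)
import Data.Bool.Properties as Bool
open import Data.Fin.Base
  using (Fin; zero; suc; punchIn; punchOut; join; splitAt; combine; remQuot; funToFin; finToFun; inject≤; fromℕ<)
open import Data.Fin.Permutation as Perm
  using (Permutation′; _⟨$⟩ʳ_; _⟨$⟩ˡ_; inverseˡ; inverseʳ; _∘ₚ_)
open import Data.Fin.Properties as Fin using (any?; all?; punchIn-punchOut; +↔⊎; *↔×; 2↔Bool)
open import Data.Fin.Subset using (Subset; _∈_; _∉_)
open import Data.Fin.Subset.Properties using (_∈?_; x∈∁p⇒x∉p; x∉p⇒x∈∁p)
import Data.Integer.Base as ℤ
import Data.Integer.Properties as ℤ
open import Data.Nat.Base
  using (ℕ; zero; suc; _+_; _*_; _^_; _∸_; _/_; _≤_; _<_; z≤n; s≤s; ⌊_/2⌋; ⌈_/2⌉; NonZero)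
open import Data.Nat.DivMod using (m/n*n≤m; m*n/n≡m; /-monoˡ-≤)
import Data.Nat.Properties as ℕ
open import Data.Nat.Solver using (module +-*-Solver)
open import Data.Product.Base using (∃; ∃₂; _×_; _,_; proj₁; proj₂)
open import Data.Product.Function.NonDependent.Propositional using (_×-↔_)
open import Data.Rational.Base as ℚ using (mkℚ; 0ℚ; 1ℚ)
import Data.Rational.Properties as ℚ
open import Data.Rational.Unnormalised.Base as ℚᵘ using (mkℚᵘ; *≤*; *<*)
import Data.Rational.Unnormalised.Properties as ℚᵘ
open import Data.Sum.Algebra using (⊎-comm)
open import Data.Sum.Base using (_⊎_; inj₁; inj₂; [_,_]′)
open import Data.Sum.Function.Propositional using (_⊎-↔_)
open import Data.Sum.Properties using (inj₁-injective; inj₂-injective)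
open import Data.Vec.Base using (tabulate)
open import Data.Vec.Properties using (lookup∘tabulate; lookup⇒[]=; []=⇒lookup)
open import Function.Base using (_∘_; const)
open import Function.Bundles using (Bijection; Injection; Inverse; _↔_; mk↔ₛ′)
open import Function.Construct.Composition using (_↔-∘_)
open import Function.Construct.Identity using (↔-id)
open import Function.Construct.Symmetry using (↔-sym)
open import Function.Properties.Inverse using (↔⇒↣)
open import Relation.Binary.Bundles using (Setoid)
open import Relation.Binary.PropositionalEquality
open import Relation.Nullary using (Dec; yes; no; ¬_; contradiction)
open import Relation.Nullary.Decidable using (_×-dec_; ¬?)

open import Defs
open +-*-Solver using (solve; _:+_; _:*_; _:=_; con)

-- Deleting the edges inside the clique turns a split graph with a chosen partition into
-- a bicolored graph.  The partition is unique up to isomorphism once no clique vertex is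
-- without stable neighbors, and bicolored graphs with an isolated green vertex
-- correspond to bicolored graphs on one vertex fewer.  Hence
-- b̃ (n + 1) - b̃ n ≤ s̃ (n + 1) ≤ b̃ (n + 1), and it remains to see that b̃ n / b̃ (n + 1) → 0.
--
-- In a bicolored graph H on m vertices choose r disjoint blocks of k vertices in the larger
-- color class and join a new vertex of the other color to a union of blocks, in 2 ^ r ways.
-- If the resulting graphs, each with its new vertex marked, are pairwise non-isomorphic for
-- every H in a set of classes, then this set has at most b̃ (m + 1) * (m + 1) / 2 ^ r elements.
-- Otherwise H has an automorphism moving some block off itself, so the edges at that block
-- are determined by the remaining ones, and there are at most 2 ^ ((m - k)² / 4 + O(m log m))
-- such classes, whereas b̃ (m + 1) ≥ 2 ^ ((m + 1)² / 4 - O(m log m)).  Taking r and k of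
-- order log m makes both contributions negligible.

-- Classes and representatives of a counted setoid

module Classes {a ℓ} {S : Setoid a ℓ} {k : ℕ} (classes : HasClasses S k) where
  open Setoid S using (Carrier; _≈_)
  open Bijection classes using (surjective) renaming (to to rep; injective to rep-injective) public

  class : Carrier → Fin k
  class x = proj₁ (surjective x)

  rep-class : ∀ x → rep (class x) ≈ x
  rep-class x = proj₂ (surjective x) refl

  class-injective : ∀ {x y} → class x ≡ class y → x ≈ y
  class-injective {x} {y} e = Setoid.trans S
    (Setoid.sym S (rep-class x)) (Setoid.trans S (Setoid.reflexive S (cong rep e)) (rep-class y))

  class-cong : ∀ {x y} → x ≈ y → class x ≡ class y
  class-cong {x} {y} e = rep-injective
    (Setoid.trans S (rep-class x) (Setoid.trans S e (Setoid.sym S (rep-class y))))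

  class-rep : ∀ i → class (rep i) ≡ i
  class-rep i = rep-injective (rep-class (rep i))

module Split {n} = Classes (proj₂ (splitClasses n))
module Bicolored {n} = Classes (proj₂ (bicoloredClasses n))

sameColor⇒nonadjacent : ∀ {n} (B : BicoloredGraph n) {u v} → color B u ≡ color B v →
                        adj (graph B) u v ≡ false
sameColor⇒nonadjacent B {u} {v} e = Bool.¬-not λ a → proper B u v a e

-- Split graphs from bicolored graphs

fillEdge : ∀ {ℓ} {P : Set ℓ} → Color → Color → Dec P → Bool → Bool
fillEdge green green (yes _) _ = false
fillEdge green green (no _)  _ = true
fillEdge green red   _       b = b
fillEdge red   _     _       b = b

fillEdge-sym : ∀ {n} (u v : Fin n) c d {b b′} → b ≡ b′ →
               fillEdge c d (u Fin.≟ v) b ≡ fillEdge d c (v Fin.≟ u) b′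
fillEdge-sym u v green red   e = e
fillEdge-sym u v red   green e = e
fillEdge-sym u v red   red   e = e
fillEdge-sym u v green green _ with u Fin.≟ v | v Fin.≟ u
... | yes _ | yes _ = refl
... | no _  | no _  = refl
... | yes p | no ¬q = contradiction (sym p) ¬q
... | no ¬p | yes q = contradiction (sym q) ¬p

fillEdge-loop : ∀ {n} (v : Fin n) c {b} → b ≡ false → fillEdge c c (v Fin.≟ v) b ≡ false
fillEdge-loop v red   e = e
fillEdge-loop v green _ with v Fin.≟ v
... | yes _ = refl
... | no ¬p = contradiction refl ¬p

fill : ∀ {n} → BicoloredGraph n → Graph n
fill B = record
  { adj      = λ u v → fillEdge (color B u) (color B v) (u Fin.≟ v) (adj (graph B) u v)
  ; adj-sym  = λ u v → fillEdge-sym u v (color B u) (color B v) (adj-sym (graph B) u v)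
  ; loopless = λ v → fillEdge-loop v (color B v) (loopless (graph B) v)
  }

module _ {n} (B : BicoloredGraph n) where

  fill-green : ∀ {u v} → color B u ≡ green → color B v ≡ green → u ≢ v → adj (fill B) u v ≡ true
  fill-green {u} {v} p q u≢v rewrite p | q with u Fin.≟ v
  ... | yes u≡v = contradiction u≡v u≢v
  ... | no _    = refl

  fill-redˡ : ∀ {u v} → color B u ≡ red → adj (fill B) u v ≡ adj (graph B) u v
  fill-redˡ p rewrite p = refl

  fill-redʳ : ∀ {u v} → color B v ≡ red → adj (fill B) u v ≡ adj (graph B) u v
  fill-redʳ {u} {v} p = trans (adj-sym (fill B) u v) (trans (fill-redˡ p) (adj-sym (graph B) v u))

  fill-red : ∀ {u v} → color B u ≡ red → color B v ≡ red → adj (fill B) u v ≡ false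
  fill-red p q = trans (fill-redˡ p) (sameColor⇒nonadjacent B (trans p (sym q)))

fill-cong : ∀ {n} (B C : BicoloredGraph n) π → PreservesAdj (graph B) (graph C) π →
            PreservesColor B C π → PreservesAdj (fill B) (fill C) π
fill-cong B C π p c u v rewrite sym (c u) | sym (c v) | sym (p u v) with color B u | color B v
... | green | red = refl
... | red   | _   = refl
... | green | green with u Fin.≟ v | (π ⟨$⟩ʳ u) Fin.≟ (π ⟨$⟩ʳ v)
...   | yes _ | yes _ = refl
...   | no _  | no _  = refl
...   | yes p | no ¬q = contradiction (cong (π ⟨$⟩ʳ_) p) ¬q
...   | no ¬p | yes q = contradiction (Injection.injective (↔⇒↣ π) q) ¬p

-- `fill` alters only pairs of green vertices, and equal colors exclude edges in `B` and `C` alike,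
-- so the colors suffice to recover the original edges.
fill-reflects : ∀ {n} (B C : BicoloredGraph n) π → PreservesAdj (fill B) (fill C) π →
                PreservesColor B C π → B ≅ᵇ C
fill-reflects B C π p c = π , preserves , c
  where
  preserves : PreservesAdj (graph B) (graph C) π
  preserves u v with color B u in eu | color B v in ev
  ... | green | green = trans (sameColor⇒nonadjacent B (trans eu (sym ev)))
          (sym (sameColor⇒nonadjacent C (trans (sym (c u)) (trans (trans eu (sym ev)) (c v)))))
  ... | red   | _     = trans (sym (fill-redˡ B eu)) (trans (p u v) (fill-redˡ C (trans (sym (c u)) eu)))
  ... | green | red   = trans (sym (fill-redʳ B ev)) (trans (p u v) (fill-redʳ C (trans (sym (c v)) ev)))

isGreen : Color → Bool
isGreen green = true
isGreen red   = false

isGreen⁻ : ∀ {c} → isGreen c ≡ true → c ≡ green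
isGreen⁻ {green} _ = refl

greens : ∀ {n} → BicoloredGraph n → Subset n
greens B = tabulate (isGreen ∘ color B)

∈-greens⁻ : ∀ {n} (B : BicoloredGraph n) {v} → v ∈ greens B → color B v ≡ green
∈-greens⁻ B {v} v∈ = isGreen⁻ (trans (sym (lookup∘tabulate _ v)) ([]=⇒lookup v∈))

∉-greens⁻ : ∀ {n} (B : BicoloredGraph n) {v} → v ∉ greens B → color B v ≡ red
∉-greens⁻ B {v} v∉ with color B v in e
... | red   = refl
... | green = contradiction (lookup⇒[]= v _ (trans (lookup∘tabulate _ v) (cong isGreen e))) v∉

fillSplit : ∀ {n} → BicoloredGraph n → SplitGraph n
fillSplit B = fill B , greens B
  , (λ u v u∈ v∈ → fill-green B (∈-greens⁻ B u∈) (∈-greens⁻ B v∈))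
  , λ u v u∈ v∈ a → contradiction
      (trans (sym a) (fill-red B (∉-greens⁻ B (x∈∁p⇒x∉p u∈)) (∉-greens⁻ B (x∈∁p⇒x∉p v∈)))) λ ()

-- The pair `v`, `w` is mapped to itself, so symmetry of adjacency settles it; every other affected
-- pair has one end outside and is covered by `twins`.
twins-swap : ∀ {n} (G : Graph n) {v w} → (∀ u → u ≢ v → u ≢ w → adj G u v ≡ adj G u w) →
             PreservesAdj G G (Perm.transpose v w)
twins-swap G {v} {w} twins = swap
  where
  swap : PreservesAdj G G (Perm.transpose v w)
  swap u t with u Fin.≟ v | t Fin.≟ v
  ... | yes refl | yes refl = trans (loopless G u) (sym (loopless G w))
  ... | yes refl | no t≢v with t Fin.≟ w
  ...   | yes refl = adj-sym G u t
  ...   | no t≢w   = trans (adj-sym G u t) (trans (twins t t≢v t≢w) (adj-sym G t w))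
  swap u t | no u≢v | yes refl with u Fin.≟ w
  ... | yes refl = adj-sym G u t
  ... | no u≢w   = twins u u≢v u≢w
  swap u t | no u≢v | no t≢v with u Fin.≟ w | t Fin.≟ w
  ... | yes refl | yes refl = trans (loopless G u) (sym (loopless G v))
  ... | yes refl | no t≢w   = trans (adj-sym G u t) (trans (sym (twins t t≢v t≢w)) (adj-sym G t v))
  ... | no u≢w   | yes refl = sym (twins u u≢v u≢w)
  ... | no _     | no _     = refl

green-or-red : ∀ c → c ≡ green ⊎ c ≡ red
green-or-red green = inj₁ refl
green-or-red red   = inj₂ refl

IsolatedGreen : ∀ {n} → BicoloredGraph n → Fin n → Set
IsolatedGreen B v = color B v ≡ green × (∀ u → adj (graph B) v u ≡ false)

isolatedGreen? : ∀ {n} (B : BicoloredGraph n) v → Dec (IsolatedGreen B v)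
isolatedGreen? B v = (color B v ≟ᶜ green) ×-dec all? (λ u → adj (graph B) v u Bool.≟ false)

¬isolated⇒neighbor : ∀ {n} (B : BicoloredGraph n) {v} → color B v ≡ green → ¬ IsolatedGreen B v →
                     ∃ λ u → Adj (graph B) v u × color B u ≡ red
¬isolated⇒neighbor B {v} cv ¬iso with any? (λ u → adj (graph B) v u Bool.≟ true)
... | no ¬adj = contradiction (cv , λ u → Bool.¬-not λ a → ¬adj (u , a)) ¬iso
... | yes (u , a) with color B u in cu
...   | red   = u , a , cu
...   | green = contradiction (trans cv (sym cu)) (proper B v u a)

Moves : ∀ {n} → BicoloredGraph n → BicoloredGraph n → Fin n → Set
Moves B C v = color B v ≡ green × color C v ≡ red

moves? : ∀ {n} (B C : BicoloredGraph n) v → Dec (Moves B C v)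
moves? B C v = (color B v ≟ᶜ green) ×-dec (color C v ≟ᶜ red)

-- Two such vertices would be adjacent in the clique of `fill B` and nonadjacent in the stable set
-- of `fill C`.
moves-unique : ∀ {n} (B C : BicoloredGraph n) → SameAdj (fill B) (fill C) → ∀ {u v} →
               Moves B C u → Moves B C v → u ≡ v
moves-unique B C same {u} {v} (bu , cu) (bv , cv) with u Fin.≟ v
... | yes p = p
... | no u≢v = contradiction
        (trans (sym (fill-green B bu bv u≢v)) (trans (same u v) (fill-red C cu cv))) λ ()

-- In `B` the vertex `v` has a red neighbor `w`. The edge survives in `fill C`, where `v` is stable,
-- so `w` must be green there.
moves-back : ∀ {n} (B C : BicoloredGraph n) → SameAdj (fill B) (fill C) → ∀ {v} →
             Moves B C v → ¬ IsolatedGreen B v → ∃ (Moves C B)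
moves-back B C same {v} (bv , cv) ¬iso with ¬isolated⇒neighbor B bv ¬iso
... | w , a , bw with color C w in cw
...   | green = w , cw , bw
...   | red   = contradiction
        (trans (sym (trans (sym (same v w)) (trans (fill-redʳ B bw) a))) (fill-red C cv cw)) λ ()

-- A vertex v that moves from the clique to the stable set and a vertex w that moves
-- the other way are twins, so exchanging them identifies the two partitions.
sameFill⇒≅ : ∀ {n} (B C : BicoloredGraph n) → SameAdj (fill B) (fill C) →
             (∀ v → ¬ IsolatedGreen B v) → (∀ v → ¬ IsolatedGreen C v) → B ≅ᵇ C
sameFill⇒≅ B C same ¬isoB ¬isoC with any? (moves? B C) | any? (moves? C B)
... | yes (v , mv) | no ¬m = contradiction (moves-back B C same mv (¬isoB v)) ¬m
... | no ¬m | yes (v , mv) =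
        contradiction (moves-back C B (λ u w → sym (same u w)) mv (¬isoC v)) ¬m
... | no ¬m | no ¬m′ = fill-reflects B C Perm.id same sameColor
  where
  sameColor : ∀ v → color B v ≡ color C v
  sameColor v with color B v in b | color C v in c
  ... | green | green = refl
  ... | red   | red   = refl
  ... | green | red   = contradiction (v , b , c) ¬m
  ... | red   | green = contradiction (v , c , b) ¬m′
... | yes (v , bv , cv) | yes (w , cw , bw) =
        fill-reflects B C τ (λ u t → trans (twins-swap (fill B) twins u t) (same _ _)) swapColor
  where
  τ = Perm.transpose v w

  same′ : SameAdj (fill C) (fill B)
  same′ u t = sym (same u t)

  -- By `moves-unique`, `u` has the same color in `B` and `C`. If green, it meets `v` in the clique
  -- of `B` and `w` in the clique of `C`; if red, it meets neither.
  twins : ∀ u → u ≢ v → u ≢ w → adj (fill B) u v ≡ adj (fill B) u w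
  twins u u≢v u≢w with green-or-red (color B u) | green-or-red (color C u)
  ... | inj₁ b | inj₁ c = trans (fill-green B b bv u≢v) (sym (trans (same u w) (fill-green C c cw u≢w)))
  ... | inj₂ b | inj₂ c = trans (trans (same u v) (fill-red C c cv)) (sym (fill-red B b bw))
  ... | inj₁ b | inj₂ c = contradiction (moves-unique B C same (b , c) (bv , cv)) u≢v
  ... | inj₂ b | inj₁ c = contradiction (moves-unique C B same′ (c , b) (cw , bw)) u≢w

  swapColor : ∀ u → color B u ≡ color C (τ ⟨$⟩ʳ u)
  swapColor u with u Fin.≟ v
  ... | yes refl = trans bv (sym cw)
  ... | no u≢v with u Fin.≟ w
  ...   | yes refl = trans bw (sym cv)
  ...   | no u≢w with color B u in b | color C u in c
  ...     | green | green = refl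
  ...     | red   | red   = refl
  ...     | green | red   = contradiction (moves-unique B C same (b , c) (bv , cv)) u≢v
  ...     | red   | green = contradiction (moves-unique C B same′ (c , b) (cw , bw)) u≢w

relabelGraph : ∀ {m n} → Perm.Permutation m n → Graph n → Graph m
relabelGraph π G = record
  { adj      = λ u v → adj G (π ⟨$⟩ʳ u) (π ⟨$⟩ʳ v)
  ; adj-sym  = λ u v → adj-sym G _ _
  ; loopless = λ v → loopless G _
  }

relabel : ∀ {m n} → Perm.Permutation m n → BicoloredGraph n → BicoloredGraph m
relabel π B = record
  { graph  = relabelGraph π (graph B)
  ; color  = λ v → color B (π ⟨$⟩ʳ v)
  ; proper = λ u v → proper B _ _
  }

relabel-≅ : ∀ {n} (π : Permutation′ n) (B : BicoloredGraph n) → relabel π B ≅ᵇ B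
relabel-≅ π B = π , (λ _ _ → refl) , λ _ → refl

-- Relabelling `C` along the isomorphism makes the two fills agree edge by edge, which reduces the
-- claim to `sameFill⇒≅`.
fill-injective : ∀ {n} (B C : BicoloredGraph n) →
                 (∀ v → ¬ IsolatedGreen B v) → (∀ v → ¬ IsolatedGreen C v) →
                 fill B ≅ fill C → B ≅ᵇ C
fill-injective {n} B C ¬isoB ¬isoC (π , p) =
  Setoid.trans (bicoloredSetoid n) {B} {relabel π C} {C}
    (sameFill⇒≅ B (relabel π C)
      (λ u v → trans (p u v) (sym (fill-cong (relabel π C) C π (λ _ _ → refl) (λ _ → refl) u v)))
      ¬isoB
      (λ v (g , iso) → ¬isoC (π ⟨$⟩ʳ v) (g , λ u →
        trans (cong (adj (graph C) _) (sym (inverseʳ π))) (iso (π ⟨$⟩ˡ u)))))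
    (relabel-≅ π C)

-- Removal of isolated green vertices

delete : ∀ {n} → Fin (suc n) → BicoloredGraph (suc n) → BicoloredGraph n
delete v B = record
  { graph  = record
    { adj      = λ u w → adj (graph B) (punchIn v u) (punchIn v w)
    ; adj-sym  = λ u w → adj-sym (graph B) _ _
    ; loopless = λ u → loopless (graph B) _
    }
  ; color  = λ u → color B (punchIn v u)
  ; proper = λ u w → proper B _ _
  }

punchIn-elim : ∀ {n p} (P : Fin (suc n) → Set p) (v : Fin (suc n)) →
               P v → (∀ u → P (punchIn v u)) → ∀ u → P u
punchIn-elim P v here there u with v Fin.≟ u
... | yes refl = here
... | no v≢u   = subst P (punchIn-punchOut v≢u) (there (punchOut v≢u))

insert-self : ∀ {m n} (i : Fin (suc m)) (j : Fin (suc n)) π → Perm.insert i j π ⟨$⟩ʳ i ≡ j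
insert-self i j π with i Fin.≟ i
... | yes _ = refl
... | no ¬p = contradiction refl ¬p

-- `Perm.insert` extends the isomorphism of the remainders by sending `v` to `w`: both are green and
-- have no edges.
delete-injective : ∀ {n} (B C : BicoloredGraph (suc n)) {v w} → IsolatedGreen B v → IsolatedGreen C w →
                   delete v B ≅ᵇ delete w C → B ≅ᵇ C
delete-injective {n} B C {v} {w} (bv , isoB) (cw , isoC) (π , p , c) = ρ , preserves , colors
  where
  ρ = Perm.insert v w π

  ρ-v : ρ ⟨$⟩ʳ v ≡ w
  ρ-v = insert-self v w π

  ρ-punchIn : ∀ u → ρ ⟨$⟩ʳ punchIn v u ≡ punchIn w (π ⟨$⟩ʳ u)
  ρ-punchIn = Perm.insert-punchIn v w π

  isoAt-v : ∀ t → adj (graph B) v t ≡ adj (graph C) (ρ ⟨$⟩ʳ v) (ρ ⟨$⟩ʳ t)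
  isoAt-v t rewrite ρ-v = trans (isoB t) (sym (isoC _))

  preserves : PreservesAdj (graph B) (graph C) ρ
  preserves = punchIn-elim _ v isoAt-v λ u → punchIn-elim _ v
    (trans (adj-sym (graph B) _ _) (trans (isoAt-v _) (adj-sym (graph C) _ _)))
    (λ t → trans (p u t) (sym (cong₂ (adj (graph C)) (ρ-punchIn u) (ρ-punchIn t))))

  colors : PreservesColor B C ρ
  colors = punchIn-elim _ v
    (trans bv (sym (trans (cong (color C) ρ-v) cw)))
    (λ u → trans (c u) (sym (cong (color C) (ρ-punchIn u))))

join-injective : ∀ m n {x y} → join m n x ≡ join m n y → x ≡ y
join-injective m n {x} {y} e =
  trans (sym (Fin.splitAt-join m n x)) (trans (cong (splitAt m) e) (Fin.splitAt-join m n y))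

-- Classes with an isolated green vertex inject into the classes on `m` vertices by deleting one
-- such vertex; all others inject into the split classes by `fill`.
b̃-suc≤ : ∀ m → b̃ (suc m) ≤ s̃ (suc m) + b̃ m
b̃-suc≤ m = Fin.injective⇒≤ {f = join (s̃ (suc m)) (b̃ m) ∘ target} λ {i} {j} e →
             target-injective i j (join-injective (s̃ (suc m)) (b̃ m) e)
  where
  B : Fin (b̃ (suc m)) → BicoloredGraph (suc m)
  B = Bicolored.rep

  target : Fin (b̃ (suc m)) → Fin (s̃ (suc m)) ⊎ Fin (b̃ m)
  target i with any? (isolatedGreen? (B i))
  ... | yes (v , _) = inj₂ (Bicolored.class (delete v (B i)))
  ... | no _        = inj₁ (Split.class (fillSplit (B i)))

  target-injective : ∀ i j → target i ≡ target j → i ≡ j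
  target-injective i j e with any? (isolatedGreen? (B i)) | any? (isolatedGreen? (B j))
  ... | yes (_ , p) | yes (_ , q) = Bicolored.rep-injective
          (delete-injective (B i) (B j) p q (Bicolored.class-injective (inj₂-injective e)))
  ... | no ¬p | no ¬q = Bicolored.rep-injective
          (fill-injective (B i) (B j) (λ v p → ¬p (v , p)) (λ v q → ¬q (v , q))
            (Split.class-injective (inj₁-injective e)))

-- Bicolored graphs from split graphs

-- Red pairs are cleared too, so that properness follows from the colors alone; in a split graph
-- they carry no edge, so `fill` still restores the graph.
unfillEdge : Color → Color → Bool → Bool
unfillEdge green green _ = false
unfillEdge red   red   _ = false
unfillEdge green red   b = b
unfillEdge red   green b = b

unfillEdge-sym : ∀ c d {b b′} → b ≡ b′ → unfillEdge c d b ≡ unfillEdge d c b′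
unfillEdge-sym green green _ = refl
unfillEdge-sym green red   e = e
unfillEdge-sym red   green e = e
unfillEdge-sym red   red   _ = refl

unfillEdge-proper : ∀ c d {b} → unfillEdge c d b ≡ true → c ≢ d
unfillEdge-proper green red   _ ()
unfillEdge-proper red   green _ ()

unfillEdge-same : ∀ c {b} → unfillEdge c c b ≡ false
unfillEdge-same green = refl
unfillEdge-same red   = refl

colorBy : ∀ {p} {P : Set p} → Dec P → Color
colorBy (yes _) = green
colorBy (no _)  = red

unfill : ∀ {n} → SplitGraph n → BicoloredGraph n
unfill (G , K , _) = record
  { graph = record
    { adj      = λ u v → unfillEdge (colorBy (u ∈? K)) (colorBy (v ∈? K)) (adj G u v)
    ; adj-sym  = λ u v → unfillEdge-sym (colorBy (u ∈? K)) _ (adj-sym G u v)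
    ; loopless = λ v → unfillEdge-same (colorBy (v ∈? K))
    }
  ; color  = λ v → colorBy (v ∈? K)
  ; proper = λ u v → unfillEdge-proper _ _
  }

fill-unfill : ∀ {n} (G : SplitGraph n) → SameAdj (proj₁ G) (fill (unfill G))
fill-unfill (G , K , clique , stable) u v with u ∈? K | v ∈? K
... | yes _   | no _   = refl
... | no _    | yes _  = refl
... | no u∉   | no v∉  = Bool.¬-not (stable u v (x∉p⇒x∈∁p u∉) (x∉p⇒x∈∁p v∉))
... | yes u∈  | yes v∈ with u Fin.≟ v
...   | yes refl = loopless G u
...   | no u≢v   = clique u v u∈ v∈ u≢v

unfill-injective : ∀ {n} (G H : SplitGraph n) → unfill G ≅ᵇ unfill H → proj₁ G ≅ proj₁ H
unfill-injective G H (π , p , c) = π , λ u v → trans (fill-unfill G u v)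
  (trans (fill-cong (unfill G) (unfill H) π p c u v) (sym (fill-unfill H _ _)))

-- Each split class contributes the partition stored with its representative; since `fill` undoes
-- `unfill`, different classes give different bicolored classes.
s̃≤b̃ : ∀ n → s̃ n ≤ b̃ n
s̃≤b̃ n = Fin.injective⇒≤ {f = Bicolored.class ∘ unfill ∘ Split.rep} λ {i} {j} e →
  Split.rep-injective (unfill-injective (Split.rep i) (Split.rep j) (Bicolored.class-injective e))

-- Opposite colors and encodings in finite sets

opposite : Color → Color
opposite green = red
opposite red   = green

opposite-≢ : ∀ c → c ≢ opposite c
opposite-≢ green ()
opposite-≢ red ()

funToFin-injective : ∀ {m n} (f g : Fin m → Fin n) → funToFin f ≡ funToFin g → ∀ i → f i ≡ g i
funToFin-injective f g e i = trans (sym (Fin.finToFun-funToFin f i))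
  (trans (cong (λ z → finToFun z i) e) (Fin.finToFun-funToFin g i))

finToFun-injective : ∀ {m n} (w w′ : Fin (n ^ m)) → (∀ i → finToFun w i ≡ finToFun w′ i) → w ≡ w′
finToFun-injective {m} {n} w w′ e = trans (sym (Fin.funToFin-finToFin {m} {n} w))
  (trans (funToFin-cong m e) (Fin.funToFin-finToFin {m} {n} w′))
  where
  funToFin-cong : ∀ m {n} {f g : Fin m → Fin n} → (∀ i → f i ≡ g i) → funToFin f ≡ funToFin g
  funToFin-cong zero    _ = refl
  funToFin-cong (suc m) e = cong₂ combine (e zero) (funToFin-cong m (e ∘ suc))

module _ {X : Set} {N : ℕ} (X↔ : Fin N ↔ X) {E : ℕ} .(N≤E : N ≤ E) where

  -- Padding to `E` bits gives functions on sets of different sizes a common codomain. As the bound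
  -- is irrelevant, codes built with different proofs of it can be compared.
  encodeBits : (X → Bool) → Fin (2 ^ E)
  encodeBits f = inject≤ (funToFin (Inverse.from 2↔Bool ∘ f ∘ Inverse.to X↔)) (ℕ.^-monoʳ-≤ 2 N≤E)

  encodeBits-injective : ∀ f g → encodeBits f ≡ encodeBits g → ∀ x → f x ≡ g x
  encodeBits-injective f g e x = trans (cong f (sym x≡)) (trans fg (cong g x≡))
    where
    n = Inverse.from X↔ x
    x≡ : Inverse.to X↔ n ≡ x
    x≡ = Inverse.inverseˡ X↔ refl
    fg : f (Inverse.to X↔ n) ≡ g (Inverse.to X↔ n)
    fg = Injection.injective (↔⇒↣ (↔-sym 2↔Bool))
           (funToFin-injective _ _ (Fin.inject≤-injective (ℕ.^-monoʳ-≤ 2 N≤E) (ℕ.^-monoʳ-≤ 2 N≤E) _ _ e) n)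

-- Extension by one vertex

module _ {m} (x : Color) (G : BicoloredGraph m) (T : Fin m → Bool)
         (T⊆x : ∀ v → T v ≡ true → color G v ≡ x) where

  extend : BicoloredGraph (suc m)
  extend = record
    { graph  = record { adj = a ; adj-sym = a-sym ; loopless = a-loop }
    ; color  = c
    ; proper = a-proper
    }
    where
    a : Fin (suc m) → Fin (suc m) → Bool
    a zero    zero    = false
    a zero    (suc v) = T v
    a (suc u) zero    = T u
    a (suc u) (suc v) = adj (graph G) u v

    a-sym : ∀ u v → a u v ≡ a v u
    a-sym zero    zero    = refl
    a-sym zero    (suc v) = refl
    a-sym (suc u) zero    = refl
    a-sym (suc u) (suc v) = adj-sym (graph G) u v

    a-loop : ∀ v → a v v ≡ false
    a-loop zero    = refl
    a-loop (suc v) = loopless (graph G) v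

    c : Fin (suc m) → Color
    c zero    = opposite x
    c (suc v) = color G v

    a-proper : ∀ u v → a u v ≡ true → c u ≢ c v
    a-proper zero    (suc v) t e = opposite-≢ x (sym (trans e (T⊆x v t)))
    a-proper (suc u) zero    t e = opposite-≢ x (trans (sym (T⊆x u t)) e)
    a-proper (suc u) (suc v) t   = proper G u v t

-- Both isomorphisms send the same vertex of `C` to the new vertex `zero`, so the composite `ρ`
-- fixes it. Removing `zero` leaves an isomorphism of the base graphs, and the edges at `zero` show
-- that it carries `T` to `U`.
restrict : ∀ {m} {C : BicoloredGraph (suc m)} {x y} {G H : BicoloredGraph m} {T U}
           {T⊆x : ∀ v → T v ≡ true → color G v ≡ x} {U⊆y : ∀ v → U v ≡ true → color H v ≡ y}
           (φ : C ≅ᵇ extend x G T T⊆x) (ψ : C ≅ᵇ extend y H U U⊆y) → proj₁ φ ⟨$⟩ˡ zero ≡ proj₁ ψ ⟨$⟩ˡ zero →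
           ∃ λ σ → PreservesAdj (graph G) (graph H) σ × PreservesColor G H σ × (∀ v → T v ≡ U (σ ⟨$⟩ʳ v))
restrict {m} {C} {x} {y} {G} {H} {T} {U} {T⊆x} {U⊆y} (φ , p , c) (ψ , q , d) e =
  Perm.remove zero ρ
  , (λ u v → trans (adjρ (suc u) (suc v)) (sym (cong₂ (adj (graph E′)) (ρ-suc u) (ρ-suc v))))
  , (λ v → trans (trans (trans (cong (color E) (sym (inverseʳ φ))) (sym (c _))) (d _))
                 (sym (cong (color E′) (ρ-suc v))))
  , (λ v → trans (adjρ zero (suc v)) (sym (cong₂ (adj (graph E′)) (sym ρ-zero) (ρ-suc v))))
  where
  E = extend x G T T⊆x
  E′ = extend y H U U⊆y
  ρ = Perm.flip φ ∘ₚ ψ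

  ρ-zero : ρ ⟨$⟩ʳ zero ≡ zero
  ρ-zero = trans (cong (ψ ⟨$⟩ʳ_) e) (inverseʳ ψ)

  ρ-suc : ∀ v → suc (Perm.remove zero ρ ⟨$⟩ʳ v) ≡ ρ ⟨$⟩ʳ suc v
  ρ-suc v = Perm.lift₀-remove ρ ρ-zero (suc v)

  adjρ : ∀ u v → adj (graph E) u v ≡ adj (graph E′) (ρ ⟨$⟩ʳ u) (ρ ⟨$⟩ʳ v)
  adjρ u v = trans (PreservesAdj-flip (graph C) (graph E) φ p u v) (q _ _)

-- Normal forms

-- The vertices of a normal form: r blocks of k vertices and a further vertices of the major
-- color, followed by the c vertices of the other color.
Row : (r k a : ℕ) → Set
Row r k a = Fin r × Fin k ⊎ Fin a

Position : (r k a c : ℕ) → Set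
Position r k a c = Row r k a ⊎ Fin c

row↔ : ∀ r k a → Fin (r * k + a) ↔ Row r k a
row↔ r k a = (*↔× ⊎-↔ ↔-id _) ↔-∘ +↔⊎

position↔ : ∀ {m} r k a c → .(m ≡ r * k + a + c) → Fin m ↔ Position r k a c
position↔ r k a c e = (row↔ r k a ⊎-↔ ↔-id _) ↔-∘ (+↔⊎ ↔-∘ Perm.cast-id e)

colorAt : ∀ {A B : Set} → Color → A ⊎ B → Color
colorAt x = [ const x , const (opposite x) ]′

consˡ : ∀ {m a c} → Fin m ↔ (Fin a ⊎ Fin c) → Fin (suc m) ↔ (Fin (suc a) ⊎ Fin c)
consˡ {m} {a} {c} e = mk↔ₛ′ to from to-from from-to
  where
  shift : Fin a ⊎ Fin c → Fin (suc a) ⊎ Fin c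
  shift = [ inj₁ ∘ suc , inj₂ ]′

  to : Fin (suc m) → Fin (suc a) ⊎ Fin c
  to zero    = inj₁ zero
  to (suc v) = shift (Inverse.to e v)

  from : Fin (suc a) ⊎ Fin c → Fin (suc m)
  from (inj₁ zero)    = zero
  from (inj₁ (suc i)) = suc (Inverse.from e (inj₁ i))
  from (inj₂ j)       = suc (Inverse.from e (inj₂ j))

  to-from : ∀ s → to (from s) ≡ s
  to-from (inj₁ zero)    = refl
  to-from (inj₁ (suc i)) = cong shift (Inverse.inverseˡ e refl)
  to-from (inj₂ j)       = cong shift (Inverse.inverseˡ e refl)

  from-shift : ∀ s → from (shift s) ≡ suc (Inverse.from e s)
  from-shift (inj₁ _) = refl
  from-shift (inj₂ _) = refl

  from-to : ∀ v → from (to v) ≡ v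
  from-to zero    = refl
  from-to (suc v) = trans (from-shift _) (cong suc (Inverse.inverseʳ e refl))

sortColors : ∀ {m} (f : Fin m → Color) →
             ∃₂ λ a c → ∃ λ (e : Fin m ↔ (Fin a ⊎ Fin c)) → ∀ s → f (Inverse.from e s) ≡ colorAt green s
sortColors {zero}  f = 0 , 0 , +↔⊎ {0} {0} , λ { (inj₁ ()) ; (inj₂ ()) }
sortColors {suc m} f with sortColors (f ∘ suc) | green-or-red (f zero)
... | a , c , e , col | inj₁ g = suc a , c , consˡ e , λ
        { (inj₁ zero) → g ; (inj₁ (suc i)) → col (inj₁ i) ; (inj₂ j) → col (inj₂ j) }
... | a , c , e , col | inj₂ g = a , suc c , ⊎-comm _ _ ↔-∘ consˡ (⊎-comm _ _ ↔-∘ e) , λ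
        { (inj₁ i) → col (inj₁ i) ; (inj₂ zero) → g ; (inj₂ (suc j)) → col (inj₂ j) }

-- `G` lies in the class `h` but has its blocks at fixed positions, so that two forms with the same
-- `major`, `a` and `c` can be compared vertex by vertex.
record NormalForm (r k : ℕ) {m} (h : Fin (b̃ m)) : Set where
  field
    major   : Color
    a c     : ℕ
    size    : m ≡ r * k + a + c
    G       : BicoloredGraph m
    isRep   : Bicolored.class G ≡ h
    colored : ∀ p → color G (Inverse.from (position↔ r k a c size) p) ≡ colorAt major p

normalize : ∀ r k {m} (h : Fin (b̃ m)) x a c (e : Fin m ↔ (Fin a ⊎ Fin c)) →
            (∀ s → color (Bicolored.rep h) (Inverse.from e s) ≡ colorAt x s) →
            r * k ≤ a → NormalForm r k h
normalize r k {m} h x a c e col rk≤a = record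
  { major = x ; a = a ∸ r * k ; c = c ; size = size
  ; G     = relabel π (Bicolored.rep h)
  ; isRep = trans (Bicolored.class-cong {x = relabel π (Bicolored.rep h)} {y = Bicolored.rep h}
                    (relabel-≅ π (Bicolored.rep h))) (Bicolored.class-rep h)
  ; colored = colored
  }
  where
  a′ = a ∸ r * k
  a≡ : r * k + a′ ≡ a
  a≡ = ℕ.m+[n∸m]≡n rk≤a

  size : m ≡ r * k + a′ + c
  size = trans (Perm.↔⇒≡ (↔-sym +↔⊎ ↔-∘ e)) (cong (_+ c) (sym a≡))

  s↔ : Position r k a′ c ↔ (Fin a ⊎ Fin c)
  s↔ = (Perm.cast-id a≡ ↔-∘ ↔-sym (row↔ r k a′)) ⊎-↔ ↔-id _

  π : Permutation′ m
  π = ↔-sym e ↔-∘ (s↔ ↔-∘ position↔ r k a′ c size)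

  colored : ∀ p → color (Bicolored.rep h) (π ⟨$⟩ʳ Inverse.from (position↔ r k a′ c size) p) ≡ colorAt x p
  colored p = trans
    (cong (color (Bicolored.rep h) ∘ Inverse.from e ∘ Inverse.to s↔)
      (Inverse.inverseˡ (position↔ r k a′ c size) {x = p} refl))
    (trans (col (Inverse.to s↔ p)) (same p))
    where
    same : ∀ p → colorAt x (Inverse.to s↔ p) ≡ colorAt x p
    same (inj₁ _) = refl
    same (inj₂ _) = refl

-- Green is taken as the major color whenever it has room for the blocks, even if it is the smaller
-- class; otherwise red has at least `m - r * k` vertices, which is enough.
normalForm : ∀ r k {m} → 2 * (r * k) ≤ m → (h : Fin (b̃ m)) → NormalForm r k h
normalForm r k {m} 2rk≤m h with sortColors (color (Bicolored.rep h))
... | a , c , e , col with ℕ.≤-total (r * k) a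
...   | inj₁ rk≤a = normalize r k h green a c e col rk≤a
...   | inj₂ a≤rk = normalize r k h red c a (⊎-comm _ _ ↔-∘ e)
          (λ { (inj₁ j) → col (inj₂ j) ; (inj₂ i) → col (inj₁ i) })
          (ℕ.+-cancelˡ-≤ (r * k) _ _ (begin
            r * k + r * k       ≡⟨ cong (r * k +_) (ℕ.+-identityʳ (r * k)) ⟨
            2 * (r * k)         ≤⟨ 2rk≤m ⟩
            m                   ≡⟨ Perm.↔⇒≡ (↔-sym +↔⊎ ↔-∘ e) ⟩
            a + c               ≤⟨ ℕ.+-monoˡ-≤ c a≤rk ⟩
            r * k + c           ∎))
  where open ℕ.≤-Reasoning

-- A pair of `h` and `w` is sent to its key if `P h` fails, and to the code of `h` together with `w`
-- if it holds. The two kinds of value lie in disjoint summands.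
keys-or-codes : ∀ {H D K A : ℕ} (P : Fin H → Set) → (∀ h → Dec (P h)) →
  (key : Fin H → Fin D → Fin K) → (∀ h h′ w w′ → ¬ P h → key h w ≡ key h′ w′ → h ≡ h′ × w ≡ w′) →
  (code : ∀ h → P h → Fin A) → (∀ h h′ p p′ → code h p ≡ code h′ p′ → h ≡ h′) →
  H * D ≤ K + A * D
keys-or-codes {H} {D} {K} {A} P P? key key-inj code code-inj = Fin.injective⇒≤ {f = f} f-injective
  where
  target : ∀ h → Dec (P h) → Fin D → Fin K ⊎ Fin (A * D)
  target h (yes p) w = inj₂ (combine (code h p) w)
  target h (no _)  w = inj₁ (key h w)

  target-injective : ∀ h h′ d d′ w w′ → target h d w ≡ target h′ d′ w′ → h ≡ h′ × w ≡ w′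
  target-injective h h′ (yes p) (yes p′) w w′ e
    with c , w≡w′ ← Fin.combine-injective (code h p) w (code h′ p′) w′ (inj₂-injective e) =
    code-inj h h′ p p′ c , w≡w′
  target-injective h h′ (no ¬p) (no _) w w′ e = key-inj h h′ w w′ ¬p (inj₁-injective e)

  f : Fin (H * D) → Fin (K + A * D)
  f q = join K (A * D) (target (proj₁ hw) (P? (proj₁ hw)) (proj₂ hw))
    where hw = remQuot {H} D q

  f-injective : ∀ {q q′} → f q ≡ f q′ → q ≡ q′
  f-injective {q} {q′} e
    with p , s ← target-injective _ _ (P? _) (P? _) _ _ (join-injective K (A * D) e) =
    trans (sym (Fin.combine-remQuot {H} D q)) (trans (cong₂ combine p s) (Fin.combine-remQuot {H} D q′))

-- Codewords

bit : ∀ {r} → Fin (2 ^ r) → Fin r → Bool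
bit {r} w i = Inverse.to 2↔Bool (finToFun {2} {r} w i)

-- The union of the blocks selected by the bits of `w`, as a set of positions.
member : ∀ {r k a c} → Fin (2 ^ r) → Position r k a c → Bool
member w (inj₁ (inj₁ (i , _))) = bit w i
member w _                     = false

member⇒row : ∀ {r k a c} x w (p : Position r k a c) → member w p ≡ true → colorAt x p ≡ x
member⇒row x w (inj₁ (inj₁ _)) _ = refl

≢-cases : ∀ b b′ → b ≢ b′ → (b ≡ true × b′ ≡ false) ⊎ (b′ ≡ true × b ≡ false)
≢-cases true  true  ≢ = contradiction refl ≢
≢-cases false false ≢ = contradiction refl ≢
≢-cases true  false _ = inj₁ (refl , refl)
≢-cases false true  _ = inj₂ (refl , refl)

bit-injective : ∀ {r} (w w′ : Fin (2 ^ r)) → (∀ i → bit w i ≡ bit w′ i) → w ≡ w′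
bit-injective {r} w w′ e = finToFun-injective {r} {2} w w′ λ i → Injection.injective (↔⇒↣ 2↔Bool) (e i)

distinguishingBit : ∀ {r} (w w′ : Fin (2 ^ r)) → w ≢ w′ →
                    ∃ λ i → (bit w i ≡ true × bit w′ i ≡ false) ⊎ (bit w′ i ≡ true × bit w i ≡ false)
distinguishingBit {r} w w′ w≢ with Fin.¬∀⟶∃¬ r _ (λ i → bit w i Bool.≟ bit w′ i) (w≢ ∘ bit-injective w w′)
... | i , ≢ = i , ≢-cases _ _ ≢

skip : ∀ {r k a} → Fin (suc r) → Row r k a → Row (suc r) k a
skip i (inj₁ (l , t)) = inj₁ (punchIn i l , t)
skip i (inj₂ s)       = inj₂ s

skip-surjective : ∀ {r k a} i (p : Row (suc r) k a) → (∀ t → p ≢ inj₁ (i , t)) → ∃ λ q → skip i q ≡ p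
skip-surjective i (inj₂ s) _ = inj₂ s , refl
skip-surjective i (inj₁ (l , t)) p∉ with i Fin.≟ l
... | yes refl = contradiction refl (p∉ t)
... | no i≢l   = inj₁ (punchOut i≢l , t) , cong (λ l → inj₁ (l , t)) (punchIn-punchOut i≢l)

-- Automorphisms moving a block off itself

module _ {m} (r′ k a c : ℕ) .(size : m ≡ suc r′ * k + a + c) where
  private
    r = suc r′

  at : Position r k a c → Fin m
  at = Inverse.from (position↔ r k a c size)

  -- `σ-separates` makes the block and its image disjoint, not merely distinct: each row of the
  -- block then repeats a row outside it, up to the order of the columns.
  record ShiftsBlock (x : Color) (G : BicoloredGraph m) (i : Fin r) (σ : Permutation′ m) : Set where
    field
      colored     : ∀ p → color G (at p) ≡ colorAt x p
      σ-adj       : PreservesAdj (graph G) (graph G) σ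
      σ-color     : PreservesColor G G σ
      σ-separates : ∀ t t′ → σ ⟨$⟩ʳ at (inj₁ (inj₁ (i , t))) ≢ at (inj₁ (inj₁ (i , t′)))

    locate : ∀ u → ∃ λ p → at p ≡ u
    locate u = Inverse.to (position↔ r k a c size) u , Inverse.inverseʳ (position↔ r k a c size) refl

    locateRow : ∀ u → color G u ≡ x → ∃ λ p → at (inj₁ p) ≡ u
    locateRow u cu with locate u
    ... | inj₁ p , e = p , e
    ... | inj₂ j , e = contradiction (trans (sym cu) (trans (cong (color G) (sym e)) (colored (inj₂ j)))) (opposite-≢ x)

    locateColumn : ∀ u → color G u ≡ opposite x → ∃ λ j → at (inj₂ j) ≡ u
    locateColumn u cu with locate u
    ... | inj₂ j , e = j , e
    ... | inj₁ p , e = contradiction (trans (sym (trans (cong (color G) (sym e)) (colored (inj₁ p)))) cu) (opposite-≢ x)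

    shifted : ∀ t → ∃ λ q → at (inj₁ (skip i q)) ≡ σ ⟨$⟩ʳ at (inj₁ (inj₁ (i , t)))
    shifted t with locateRow (σ ⟨$⟩ʳ at (inj₁ (inj₁ (i , t)))) (trans (sym (σ-color _)) (colored (inj₁ (inj₁ (i , t)))))
    ... | p , e with skip-surjective i p (λ t′ p≡ → σ-separates t t′ (trans (sym e) (cong (at ∘ inj₁) p≡)))
    ...   | q , refl = q , e

    shiftedColumn : ∀ j → ∃ λ j′ → at (inj₂ j′) ≡ σ ⟨$⟩ʳ at (inj₂ j)
    shiftedColumn j = locateColumn (σ ⟨$⟩ʳ at (inj₂ j)) (trans (sym (σ-color _)) (colored (inj₂ j)))

  open ShiftsBlock

  module _ {x G G′ i σ σ′} (S : ShiftsBlock x G i σ) (S′ : ShiftsBlock x G′ i σ′)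
           (σ≡ : ∀ u → σ ⟨$⟩ʳ u ≡ σ′ ⟨$⟩ʳ u)
           (outside : ∀ q j → adj (graph G) (at (inj₁ (skip i q))) (at (inj₂ j))
                            ≡ adj (graph G′) (at (inj₁ (skip i q))) (at (inj₂ j))) where

    -- A row of block `i` is mapped outside the block, where the graphs agree, and columns go to
    -- columns. So the entry is moved by `σ`, compared there, and moved back by the equal
    -- permutation `σ′`.
    row-column : ∀ p j → adj (graph G) (at (inj₁ p)) (at (inj₂ j)) ≡ adj (graph G′) (at (inj₁ p)) (at (inj₂ j))
    row-column (inj₂ s) j = outside (inj₂ s) j
    row-column (inj₁ (l , t)) j with l Fin.≟ i
    ... | no l≢i with skip-surjective {a = a} i (inj₁ (l , t)) (λ { _ refl → l≢i refl })
    ...   | q , e = subst (λ p → adj (graph G) (at (inj₁ p)) (at (inj₂ j)) ≡ adj (graph G′) (at (inj₁ p)) (at (inj₂ j)))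
                          e (outside q j)
    row-column (inj₁ (l , t)) j | yes refl with shifted S t | shiftedColumn S j
    ... | q , eq | j′ , ej = begin
      adj (graph G) (at (inj₁ (inj₁ (l , t)))) (at (inj₂ j))                         ≡⟨ σ-adj S _ _ ⟩
      adj (graph G) (σ ⟨$⟩ʳ at (inj₁ (inj₁ (l , t)))) (σ ⟨$⟩ʳ at (inj₂ j))           ≡⟨ cong₂ (adj (graph G)) eq ej ⟨
      adj (graph G) (at (inj₁ (skip i q))) (at (inj₂ j′))                            ≡⟨ outside q j′ ⟩
      adj (graph G′) (at (inj₁ (skip i q))) (at (inj₂ j′))                           ≡⟨ cong₂ (adj (graph G′)) (trans eq (σ≡ _)) (trans ej (σ≡ _)) ⟩
      adj (graph G′) (σ′ ⟨$⟩ʳ at (inj₁ (inj₁ (l , t)))) (σ′ ⟨$⟩ʳ at (inj₂ j))        ≡⟨ σ-adj S′ _ _ ⟨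
      adj (graph G′) (at (inj₁ (inj₁ (l , t)))) (at (inj₂ j))                        ∎
      where open ≡-Reasoning

    shiftsBlock-determines : SameAdj (graph G) (graph G′)
    shiftsBlock-determines u v with locate S u | locate S v
    ... | inj₁ p , refl | inj₂ j , refl = row-column p j
    ... | inj₂ j , refl | inj₁ p , refl =
            trans (adj-sym (graph G) _ _) (trans (row-column p j) (adj-sym (graph G′) _ _))
    ... | inj₁ p , refl | inj₁ q , refl =
            trans (sameColor⇒nonadjacent G (trans (colored S (inj₁ p)) (sym (colored S (inj₁ q)))))
             (sym (sameColor⇒nonadjacent G′ (trans (colored S′ (inj₁ p)) (sym (colored S′ (inj₁ q))))))
    ... | inj₂ p , refl | inj₂ q , refl =
            trans (sameColor⇒nonadjacent G (trans (colored S (inj₂ p)) (sym (colored S (inj₂ q)))))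
             (sym (sameColor⇒nonadjacent G′ (trans (colored S′ (inj₂ p)) (sym (colored S′ (inj₂ q))))))

-- Counting the extensions of normal forms

module Extensions (r′ k E : ℕ) {m} (nf : (h : Fin (b̃ m)) → NormalForm (suc r′) k h)
                  (cells≤E : ∀ a c → m ≡ suc r′ * k + a + c → (r′ * k + a) * c ≤ E) where
  private
    r = suc r′
    n = suc m

  module _ (h : Fin (b̃ m)) where
    open NormalForm (nf h) public

    pos : Fin m → Position r k a c
    pos = Inverse.to (position↔ r k a c size)

    attach : Fin (2 ^ r) → Fin m → Bool
    attach w v = member w (pos v)

    attach⊆major : ∀ w v → attach w v ≡ true → color G v ≡ major
    attach⊆major w v e = trans
      (cong (color G) (sym (Inverse.inverseʳ (position↔ r k a c size) refl)))
      (trans (colored (pos v)) (member⇒row major w (pos v) e))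

    extension : Fin (2 ^ r) → BicoloredGraph n
    extension w = extend major G (attach w) (attach⊆major w)

    φ : ∀ w → Bicolored.rep (Bicolored.class (extension w)) ≅ᵇ extension w
    φ w = Bicolored.rep-class (extension w)

    -- The second component marks the vertex of the representative that matches the new vertex. This
    -- allows the new vertex to be removed again, at the cost of a factor `n`.
    key : Fin (2 ^ r) → Fin (b̃ n * n)
    key w = combine (Bicolored.class (extension w)) (proj₁ (φ w) ⟨$⟩ˡ zero)

  Transfer : ∀ h w h′ w′ → Permutation′ m → Set
  Transfer h w h′ w′ σ = PreservesAdj (graph (G h)) (graph (G h′)) σ × PreservesColor (G h) (G h′) σ
                       × (∀ v → attach h w v ≡ attach h′ w′ (σ ⟨$⟩ʳ v))

  transfer : ∀ h w h′ w′ → key h w ≡ key h′ w′ → ∃ (Transfer h w h′ w′)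
  transfer h w h′ w′ e with Fin.combine-injective _ _ _ _ e
  ... | cl , v = along cl (φ h w) v
    where
    -- The variable `t` replaces the class of `extension h w`, so that the equality of classes can
    -- be matched with `refl`; the isomorphism `ψ` is abstracted along with it.
    along : ∀ {t} → t ≡ Bicolored.class (extension h′ w′) → (ψ : Bicolored.rep t ≅ᵇ extension h w) →
            proj₁ ψ ⟨$⟩ˡ zero ≡ proj₁ (φ h′ w′) ⟨$⟩ˡ zero → ∃ (Transfer h w h′ w′)
    along refl ψ = restrict {C = Bicolored.rep (Bicolored.class (extension h′ w′))}
      {T⊆x = attach⊆major h w} {U⊆y = attach⊆major h′ w′} ψ (φ h′ w′)

  G-injective : ∀ {h h′} → G h ≅ᵇ G h′ → h ≡ h′
  G-injective {h} {h′} e = trans (sym (isRep h)) (trans (Bicolored.class-cong {x = G h} {y = G h′} e) (isRep h′))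

  Ambiguous : Fin (b̃ m) → Set
  Ambiguous h = ∃₂ λ w w′ → w ≢ w′ × key h w ≡ key h w′

  ambiguous? : ∀ h → Dec (Ambiguous h)
  ambiguous? h = any? λ w → any? λ w′ → ¬? (w Fin.≟ w′) ×-dec (key h w Fin.≟ key h w′)

  Shift : ∀ {h : Fin (b̃ m)} → NormalForm r k h → Set
  Shift N = ∃₂ λ i σ → ShiftsBlock r′ k N.a N.c N.size N.major N.G i σ
    where module N = NormalForm N

  -- Under `w` the new vertex is joined to all of block `i`, hence under `w′` to the image of the
  -- block; but `w′` omits block `i`, so the image avoids it.
  shift : ∀ h w w′ i → bit w i ≡ true → bit w′ i ≡ false → key h w ≡ key h w′ → Shift (nf h)
  shift h w w′ i wi w′i e with transfer h w h w′ e
  ... | σ , σ-adj , σ-color , σ-attach = i , σ , record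
    { colored = colored h ; σ-adj = σ-adj ; σ-color = σ-color ; σ-separates = separates }
    where
    at′ : Position r k (a h) (c h) → Fin m
    at′ = at r′ k (a h) (c h) (size h)

    attach-block : ∀ w t → attach h w (at′ (inj₁ (inj₁ (i , t)))) ≡ bit w i
    attach-block w t = cong (member w) 
      (Inverse.inverseˡ (position↔ r k (a h) (c h) (size h)) {x = inj₁ (inj₁ (i , t))} refl)

    separates : ∀ t t′ → σ ⟨$⟩ʳ at′ (inj₁ (inj₁ (i , t))) ≢ at′ (inj₁ (inj₁ (i , t′)))
    separates t t′ σt = contradiction (trans (sym wi) (trans (sym (attach-block w t)) (trans (σ-attach _)
      (trans (cong (attach h w′) σt) (trans (attach-block w′ t′) w′i))))) λ ()

  ambiguous⇒shift : ∀ h → Ambiguous h → Shift (nf h)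
  ambiguous⇒shift h (w , w′ , w≢w′ , e) with distinguishingBit {r} w w′ w≢w′
  ... | i , inj₁ (wi , w′i) = shift h w w′ i wi w′i e
  ... | i , inj₂ (w′i , wi) = shift h w′ w i w′i wi (sym e)

  -- The factors count, in order, the major color, the value of `a`, the permutation as a mere
  -- function, the block, and the entries outside the block.
  ambiguousBound : ℕ
  ambiguousBound = 2 * (n * (m ^ m * (r * 2 ^ E)))

  isGreenIndex : Color → Fin 2
  isGreenIndex x = Inverse.from 2↔Bool (isGreen x)

  isGreenIndex-injective : ∀ x y → isGreenIndex x ≡ isGreenIndex y → x ≡ y
  isGreenIndex-injective green green _ = refl
  isGreenIndex-injective red   red   _ = refl

  cell↔ : ∀ a c → Fin ((r′ * k + a) * c) ↔ (Row r′ k a × Fin c)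
  cell↔ a c = (row↔ r′ k a ×-↔ ↔-id _) ↔-∘ *↔×

  module _ {h : Fin (b̃ m)} (N : NormalForm r k h) where
    private module N = NormalForm N

    a<n : N.a < n
    a<n = s≤s (ℕ.≤-trans (ℕ.m≤n+m N.a (r * k)) (ℕ.≤-trans (ℕ.m≤m+n _ N.c) (ℕ.≤-reflexive (sym N.size))))

    cells : Fin r → Row r′ k N.a × Fin N.c → Bool
    cells i (q , j) = adj (graph N.G) (at r′ k N.a N.c N.size (inj₁ (skip i q)))
                                      (at r′ k N.a N.c N.size (inj₂ j))

    code : Shift N → Fin ambiguousBound
    code (i , σ , _) =
      combine {2} {n * (m ^ m * (r * 2 ^ E))} (isGreenIndex N.major)
        (combine {n} {m ^ m * (r * 2 ^ E)} (fromℕ< a<n) (combine {m ^ m} {r * 2 ^ E} (funToFin (σ ⟨$⟩ʳ_))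
        (combine {r} {2 ^ E} i (encodeBits (cell↔ N.a N.c) (cells≤E N.a N.c N.size) (cells i)))))

  code-injective : ∀ {h h′} (N : NormalForm r k h) (N′ : NormalForm r k h′) S S′ →
                   code N S ≡ code N′ S′ → NormalForm.G N ≅ᵇ NormalForm.G N′
  code-injective N@(record { major = x ; a = a ; c = c ; size = size ; G = G })
                 N′@(record { major = x′ ; a = a′ ; c = c′ ; size = size′ ; G = G′ })
                 (i , σ , S) (i′ , σ′ , S′) e
    with e₁ , f₁ ← Fin.combine-injective {2} {n * (m ^ m * (r * 2 ^ E))} (isGreenIndex x) _ (isGreenIndex x′) _ e
    with e₂ , f₂ ← Fin.combine-injective {n} {m ^ m * (r * 2 ^ E)} (fromℕ< (a<n N)) _ (fromℕ< (a<n N′)) _ f₁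
    with e₃ , f₃ ← Fin.combine-injective {m ^ m} {r * 2 ^ E} (funToFin (σ ⟨$⟩ʳ_)) _ (funToFin (σ′ ⟨$⟩ʳ_)) _ f₂
    with refl , f₄ ← Fin.combine-injective {r} {2 ^ E} i _ i′ _ f₃
    with refl ← isGreenIndex-injective x x′ e₁
    with refl ← Fin.fromℕ<-injective a a′ (a<n N) (a<n N′) e₂
    -- The code omits `c`, which `size` determines from `a`.
    with refl ← ℕ.+-cancelˡ-≡ (r * k + a) c c′ (trans (sym size) size′) =
      Perm.id
      , shiftsBlock-determines r′ k a c size S S′ (funToFin-injective _ _ e₃)
          (λ q j → encodeBits-injective (cell↔ a c) (cells≤E a c size) (cells N i) (cells N′ i) f₄ (q , j))
      , sameColor
    where
    sameColor : ∀ v → color G v ≡ color G′ v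
    sameColor v with ShiftsBlock.locate S v
    ... | p , refl = trans (ShiftsBlock.colored S p) (sym (ShiftsBlock.colored S′ p))

  -- By `transfer`, equal keys give isomorphic base graphs, so `h ≡ h′`; two different codewords
  -- would then make `h` ambiguous.
  key-injective : ∀ h h′ w w′ → ¬ Ambiguous h → key h w ≡ key h′ w′ → h ≡ h′ × w ≡ w′
  key-injective h h′ w w′ ¬amb e
    with σ , p , c , _ ← transfer h w h′ w′ e
    with refl ← G-injective {h} {h′} (σ , p , c)
    with w Fin.≟ w′
  ... | yes w≡w′ = refl , w≡w′
  ... | no w≢w′  = contradiction (w , w′ , w≢w′ , e) ¬amb

  ambiguousCode : ∀ h → Ambiguous h → Fin ambiguousBound
  ambiguousCode h amb = code (nf h) (ambiguous⇒shift h amb)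

  ambiguousCode-injective : ∀ h h′ amb amb′ → ambiguousCode h amb ≡ ambiguousCode h′ amb′ → h ≡ h′
  ambiguousCode-injective h h′ amb amb′ e = G-injective
    (code-injective (nf h) (nf h′) (ambiguous⇒shift h amb) (ambiguous⇒shift h′ amb′) e)

  b̃-extension-bound : b̃ m * 2 ^ r ≤ b̃ n * n + ambiguousBound * 2 ^ r
  b̃-extension-bound = keys-or-codes {b̃ m} {2 ^ r} {b̃ n * n} {ambiguousBound}
    Ambiguous ambiguous? key key-injective ambiguousCode ambiguousCode-injective

-- Lower bound for b̃

bipartite : ∀ {p q} → (Fin p → Fin q → Bool) → BicoloredGraph (p + q)
bipartite {p} {q} A = relabelled
  where
  edge : Fin p ⊎ Fin q → Fin p ⊎ Fin q → Bool
  edge (inj₁ i) (inj₂ j) = A i j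
  edge (inj₂ j) (inj₁ i) = A i j
  edge (inj₁ _) (inj₁ _) = false
  edge (inj₂ _) (inj₂ _) = false

  edge-sym : ∀ s t → edge s t ≡ edge t s
  edge-sym (inj₁ _) (inj₁ _) = refl
  edge-sym (inj₁ _) (inj₂ _) = refl
  edge-sym (inj₂ _) (inj₁ _) = refl
  edge-sym (inj₂ _) (inj₂ _) = refl

  edge-loopless : ∀ s → edge s s ≡ false
  edge-loopless (inj₁ _) = refl
  edge-loopless (inj₂ _) = refl

  edge-proper : ∀ s t → edge s t ≡ true → colorAt green s ≢ colorAt green t
  edge-proper (inj₁ _) (inj₂ _) _ ()
  edge-proper (inj₂ _) (inj₁ _) _ ()

  relabelled : BicoloredGraph (p + q)
  relabelled = record
    { graph = record
      { adj      = λ u v → edge (splitAt p u) (splitAt p v)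
      ; adj-sym  = λ u v → edge-sym (splitAt p u) (splitAt p v)
      ; loopless = λ v → edge-loopless (splitAt p v)
      }
    ; color  = colorAt green ∘ splitAt p
    ; proper = λ u v → edge-proper (splitAt p u) (splitAt p v)
    }

bipartite-adj : ∀ {p q} (A : Fin p → Fin q → Bool) i j →
                adj (graph (bipartite A)) (join p q (inj₁ i)) (join p q (inj₂ j)) ≡ A i j
bipartite-adj {p} {q} A i j rewrite Fin.splitAt-↑ˡ p i q | Fin.splitAt-↑ʳ p q j = refl

-- Distinct bit matrices give distinct labelled graphs, and a labelled graph is recovered from its
-- class and the vertex map to the representative, one of at most `n ^ n` functions.
b̃-lower : ∀ p q → 2 ^ (p * q) ≤ b̃ (p + q) * (p + q) ^ (p + q)
b̃-lower p q = Fin.injective⇒≤ {f = f} λ {z} {z′} → f-injective z z′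
  where
  n = p + q

  entries : Fin (2 ^ (p * q)) → Fin p → Fin q → Bool
  entries z i j = bit {p * q} z (combine i j)

  B : Fin (2 ^ (p * q)) → BicoloredGraph n
  B z = bipartite (entries z)

  φ : ∀ z → Bicolored.rep (Bicolored.class (B z)) ≅ᵇ B z
  φ z = Bicolored.rep-class (B z)

  f : Fin (2 ^ (p * q)) → Fin (b̃ n * n ^ n)
  f z = combine {b̃ n} {n ^ n} (Bicolored.class (B z)) (funToFin (proj₁ (φ z) ⟨$⟩ˡ_))

  sameAdj : ∀ z z′ {t t′} (ψ : Bicolored.rep t ≅ᵇ B z) (ψ′ : Bicolored.rep t′ ≅ᵇ B z′) → t ≡ t′ →
            (∀ u → proj₁ ψ ⟨$⟩ˡ u ≡ proj₁ ψ′ ⟨$⟩ˡ u) → SameAdj (graph (B z)) (graph (B z′))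
  sameAdj z z′ {t} (π , a , _) (π′ , a′ , _) refl e u v =
    trans (PreservesAdj-flip (graph (Bicolored.rep t)) (graph (B z)) π a u v)
      (trans (cong₂ (adj (graph (Bicolored.rep t))) (e u) (e v))
        (sym (PreservesAdj-flip (graph (Bicolored.rep t)) (graph (B z′)) π′ a′ u v)))

  f-injective : ∀ z z′ → f z ≡ f z′ → z ≡ z′
  f-injective z z′ e
    with cl , fn ← Fin.combine-injective {b̃ n} {n ^ n} (Bicolored.class (B z)) (funToFin (proj₁ (φ z) ⟨$⟩ˡ_))
                     (Bicolored.class (B z′)) (funToFin (proj₁ (φ z′) ⟨$⟩ˡ_)) e =
    bit-injective {p * q} z z′ sameBit
    where
    same : SameAdj (graph (B z)) (graph (B z′))
    same = sameAdj z z′ (φ z) (φ z′) cl (funToFin-injective (proj₁ (φ z) ⟨$⟩ˡ_) (proj₁ (φ z′) ⟨$⟩ˡ_) fn)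

    sameEntry : ∀ i j → entries z i j ≡ entries z′ i j
    sameEntry i j = trans (sym (bipartite-adj (entries z) i j)) (trans (same _ _) (bipartite-adj (entries z′) i j))

    sameBit : ∀ x → bit {p * q} z x ≡ bit {p * q} z′ x
    sameBit x with i , j , refl ← Fin.combine-surjective {p} {q} x = sameEntry i j

-- Growth of b̃

-- The two sides differ by the square of `p - q`; ordering `p` and `q` turns this difference into a
-- natural number `d`.
4pq≤[p+q]² : ∀ p q → 4 * (p * q) ≤ (p + q) * (p + q)
4pq≤[p+q]² p q with ℕ.≤-total p q
... | inj₁ p≤q = ordered p≤q
  where
  ordered : ∀ {p q} → p ≤ q → 4 * (p * q) ≤ (p + q) * (p + q)
  ordered {p} {q} p≤q with d , refl ← ℕ.m≤n⇒∃[o]m+o≡n p≤q =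
    ℕ.≤-trans (ℕ.m≤m+n _ (d * d)) (ℕ.≤-reflexive (solve 2
      (λ p d → con 4 :* (p :* (p :+ d)) :+ d :* d := (p :+ (p :+ d)) :* (p :+ (p :+ d))) refl p d))
... | inj₂ q≤p with d , refl ← ℕ.m≤n⇒∃[o]m+o≡n q≤p =
    ℕ.≤-trans (ℕ.m≤m+n _ (d * d)) (ℕ.≤-reflexive (solve 2
      (λ q d → con 4 :* ((q :+ d) :* q) :+ d :* d := ((q :+ d) :+ q) :* ((q :+ d) :+ q)) refl q d))

pq≤[p+q]²/4 : ∀ p q → p * q ≤ (p + q) * (p + q) / 4
pq≤[p+q]²/4 p q = begin
  p * q                     ≡⟨ m*n/n≡m (p * q) 4 ⟨
  p * q * 4 / 4             ≤⟨ /-monoˡ-≤ 4 (ℕ.≤-trans (ℕ.≤-reflexive (ℕ.*-comm (p * q) 4)) (4pq≤[p+q]² p q)) ⟩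
  (p + q) * (p + q) / 4     ∎
  where open ℕ.≤-Reasoning

-- Raising `n` by 2 adds `4 * suc n` to both sides. The extra 1 is attained for odd `n`.
n²≤1+4⌊n/2⌋⌈n/2⌉ : ∀ n → n * n ≤ suc (4 * (⌊ n /2⌋ * ⌈ n /2⌉))
n²≤1+4⌊n/2⌋⌈n/2⌉ zero          = z≤n
n²≤1+4⌊n/2⌋⌈n/2⌉ (suc zero)    = s≤s z≤n
n²≤1+4⌊n/2⌋⌈n/2⌉ (suc (suc n)) = begin
  suc (suc n) * suc (suc n)           ≡⟨ solve 1 (λ n → (con 2 :+ n) :* (con 2 :+ n) := n :* n :+ con 4 :* (con 1 :+ n)) refl n ⟩
  n * n + 4 * suc n                   ≤⟨ ℕ.+-monoˡ-≤ (4 * suc n) (n²≤1+4⌊n/2⌋⌈n/2⌉ n) ⟩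
  suc (4 * (p * q)) + 4 * suc n       ≡⟨ cong (λ n → suc (4 * (p * q)) + 4 * suc n) (ℕ.⌊n/2⌋+⌈n/2⌉≡n n) ⟨
  suc (4 * (p * q)) + 4 * suc (p + q) ≡⟨ solve 2 (λ p q → con 1 :+ con 4 :* (p :* q) :+ con 4 :* (con 1 :+ (p :+ q))
                                           := con 1 :+ con 4 :* ((con 1 :+ p) :* (con 1 :+ q))) refl p q ⟩
  suc (4 * (suc p * suc q))           ∎
  where
  open ℕ.≤-Reasoning
  p = ⌊ n /2⌋
  q = ⌈ n /2⌉

log₂-bounds : ∀ m → 1 ≤ m → ∃ λ j → 2 ^ j ≤ m × suc m ≤ 2 ^ suc j
log₂-bounds (suc zero)    _ = 0 , s≤s z≤n , ℕ.≤-refl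
log₂-bounds (suc (suc m)) _ with log₂-bounds (suc m) (s≤s z≤n)
... | j , lo , hi with ℕ.m≤n⇒m<n∨m≡n hi
...   | inj₁ < = j , ℕ.m≤n⇒m≤1+n lo , <
...   | inj₂ e = suc j , ℕ.≤-reflexive (sym e) , (begin
          suc (suc (suc m))         ≤⟨ s≤s (s≤s (ℕ.n≤1+n _)) ⟩
          2 + (2 + m)               ≤⟨ ℕ.m≤n+m _ m ⟩
          m + (2 + (2 + m))         ≡⟨ solve 1 (λ m → m :+ (con 2 :+ (con 2 :+ m)) := con 2 :* (con 2 :+ m)) refl m ⟩
          2 * suc (suc m)           ≡⟨ cong (2 *_) e ⟩
          2 ^ suc (suc j)           ∎)
  where open ℕ.≤-Reasoning

-- 5 is the least `y` with this property: 49 ≤ 50, but 36 > 32.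
[2+y]²≤2y² : ∀ {y} → 5 ≤ y → (2 + y) * (2 + y) ≤ 2 * (y * y)
[2+y]²≤2y² 5≤y with z , refl ← ℕ.m≤n⇒∃[o]m+o≡n 5≤y = ℕ.≤-trans (ℕ.m≤m+n _ (1 + (6 * z + z * z)))
  (ℕ.≤-reflexive (solve 1
    (λ z → (con 7 :+ z) :* (con 7 :+ z) :+ (con 1 :+ (con 6 :* z :+ z :* z))
        := con 2 :* ((con 5 :+ z) :* (con 5 :+ z))) refl z))

Cy²≤2^suc : ∀ C {y y′} e → 5 ≤ y → y′ ≤ 2 + y → C * (y * y) ≤ 2 ^ e → C * (y′ * y′) ≤ 2 ^ suc e
Cy²≤2^suc C {y} {y′} e 5≤y y′≤ ih = begin
  C * (y′ * y′)          ≤⟨ ℕ.*-monoʳ-≤ C (ℕ.≤-trans (ℕ.*-mono-≤ y′≤ y′≤) ([2+y]²≤2y² 5≤y)) ⟩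
  C * (2 * (y * y))      ≡⟨ solve 2 (λ C x → C :* (con 2 :* x) := con 2 :* (C :* x)) refl C (y * y) ⟩
  2 * (C * (y * y))      ≤⟨ ℕ.*-monoʳ-≤ 2 ih ⟩
  2 ^ suc e              ∎
  where open ℕ.≤-Reasoning

-- Each unit of `μ` or `t` doubles the right side, while it adds 2 or 1 to the base of the square,
-- at most doubling the left side.
Cy²≤2^ : ∀ C y e → 5 ≤ y → C * (y * y) ≤ 2 ^ e → ∀ μ t →
         C * ((t + (2 * μ + y)) * (t + (2 * μ + y))) ≤ 2 ^ (t + (μ + e))
Cy²≤2^ C y e 5≤y base zero    zero    = base
Cy²≤2^ C y e 5≤y base μ       (suc t) = Cy²≤2^suc C (t + (μ + e))
  (ℕ.≤-trans 5≤y (ℕ.≤-trans (ℕ.m≤n+m y (2 * μ)) (ℕ.m≤n+m _ t))) (ℕ.n≤1+n _) (Cy²≤2^ C y e 5≤y base μ t)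
Cy²≤2^ C y e 5≤y base (suc μ) zero    = Cy²≤2^suc C (μ + e)
  (ℕ.≤-trans 5≤y (ℕ.m≤n+m y (2 * μ)))
  (ℕ.≤-reflexive (solve 2 (λ μ y → con 2 :* (con 1 :+ μ) :+ y := con 2 :+ (con 2 :* μ :+ y)) refl μ y))
  (Cy²≤2^ C y e 5≤y base μ zero)

2^-cancel-< : ∀ i j → 2 ^ i < 2 ^ j → i < j
2^-cancel-< i j lt = ℕ.≰⇒> λ j≤i → ℕ.<⇒≱ lt (ℕ.^-monoʳ-≤ 2 j≤i)

-- `ℓ` is the bit length of `m`. If `t` is the excess of `ℓ - 1` over `μ + e`, then `suc (ℓ + μ)` is
-- `t + 2 * μ + (2 + e)`, to which `Cy²≤2^` applies, and `2 ^ (ℓ - 1) ≤ m`. For `C = 48` and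
-- `e = 20` the base case is 23232 ≤ 1048576.
exponential-beats-square : ∀ C e → 3 ≤ e → C * ((2 + e) * (2 + e)) ≤ 2 ^ e → ∀ μ m → 2 ^ (μ + e) ≤ m →
  ∃ λ ℓ → suc m ≤ 2 ^ ℓ × C * (suc (ℓ + μ) * suc (ℓ + μ)) ≤ m
exponential-beats-square C e 3≤e base μ m 2^≤m with log₂-bounds m (ℕ.≤-trans (ℕ.^-monoʳ-≤ 2 {0} {μ + e} z≤n) 2^≤m)
... | j , lo , hi with t , refl ← ℕ.m≤n⇒∃[o]m+o≡n {μ + e} {j} (ℕ.≤-pred (2^-cancel-< (μ + e) (suc j) (ℕ.≤-trans (s≤s 2^≤m) hi))) =
  suc j , hi , ℕ.≤-trans
    (ℕ.≤-reflexive (cong (λ y → C * (y * y)) (solve 3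
      (λ t μ e → con 1 :+ ((con 1 :+ ((μ :+ e) :+ t)) :+ μ) := t :+ (con 2 :* μ :+ (con 2 :+ e))) refl t μ e)))
    (ℕ.≤-trans (Cy²≤2^ C (2 + e) e (s≤s (s≤s 3≤e)) base μ t)
      (ℕ.≤-trans (ℕ.≤-reflexive (cong (2 ^_) (ℕ.+-comm t (μ + e)))) lo))

-- With `k = m - s`, the square of `s` falls short of that of `m` by at least `k * m`; the factor 24
-- in `k` lets this gain absorb four times the terms of order `m log m`.
exponent-bound : ∀ μ ℓ m s → 1 ≤ m → m ≡ 24 * suc (ℓ + μ) + s →
                 μ + 2 + 2 * ℓ + 2 * (ℓ * suc m) + s * s / 4 ≤ ⌊ suc m /2⌋ * ⌈ suc m /2⌉
-- Multiplying by 4 clears the division, and adding 1 absorbs the rounding of the two halves.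
exponent-bound μ ℓ m@(suc m₀) s _ m≡ = ℕ.*-cancelˡ-≤ 4 (ℕ.+-cancelˡ-≤ 1 _ _ (begin
  1 + 4 * (X + s * s / 4)       ≡⟨ cong (1 +_) (ℕ.*-distribˡ-+ 4 X (s * s / 4)) ⟩
  1 + (4 * X + 4 * (s * s / 4)) ≤⟨ ℕ.+-monoʳ-≤ 1 (ℕ.+-mono-≤ 4X≤km (ℕ.≤-trans (ℕ.≤-reflexive (ℕ.*-comm 4 (s * s / 4))) (m/n*n≤m (s * s) 4))) ⟩
  1 + (k * m + s * s)           ≤⟨ ℕ.+-monoʳ-≤ 1 km+s²≤m² ⟩
  1 + m * m                     ≤⟨ ℕ.m≤m+n _ (2 * m) ⟩
  1 + m * m + 2 * m             ≡⟨ solve 1 (λ m → con 1 :+ m :* m :+ con 2 :* m := (con 1 :+ m) :* (con 1 :+ m)) refl m ⟩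
  suc m * suc m                 ≤⟨ n²≤1+4⌊n/2⌋⌈n/2⌉ (suc m) ⟩
  suc (4 * (⌊ suc m /2⌋ * ⌈ suc m /2⌉)) ∎))
  where
  open ℕ.≤-Reasoning
  X = μ + 2 + 2 * ℓ + 2 * (ℓ * suc m)
  k = 24 * suc (ℓ + μ)

  4X≤km : 4 * X ≤ k * m
  4X≤km = ℕ.≤-trans (ℕ.m≤m+n (4 * X) (16 + 20 * μ + 24 * m₀ + 16 * (ℓ * m₀) + 24 * (μ * m₀)))
    (ℕ.≤-reflexive (solve 3 (λ μ ℓ m →
      con 4 :* (μ :+ con 2 :+ con 2 :* ℓ :+ con 2 :* (ℓ :* (con 2 :+ m)))
        :+ (con 16 :+ con 20 :* μ :+ con 24 :* m :+ con 16 :* (ℓ :* m) :+ con 24 :* (μ :* m))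
      := con 24 :* (con 1 :+ (ℓ :+ μ)) :* (con 1 :+ m)) refl μ ℓ m₀))

  km+s²≤m² : k * m + s * s ≤ m * m
  km+s²≤m² = begin
    k * m + s * s               ≡⟨ cong (λ m → k * m + s * s) m≡ ⟩
    k * (k + s) + s * s         ≤⟨ ℕ.m≤m+n _ (k * s) ⟩
    k * (k + s) + s * s + k * s ≡⟨ solve 2 (λ k s → k :* (k :+ s) :+ s :* s :+ k :* s := (k :+ s) :* (k :+ s)) refl k s ⟩
    (k + s) * (k + s)           ≡⟨ cong (λ m → m * m) m≡ ⟨
    m * m                       ∎

-- `suc m` and `r` are at most `2 ^ ℓ`, and both self-powers at most `2 ^ (ℓ * suc m)`. The left
-- side is `2 ^ suc μ * ambiguousBound` times the factor lost in `b̃-lower`.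
power-bound : ∀ μ ℓ E {m r} → 1 ≤ m → suc m ≤ 2 ^ ℓ → r ≤ m →
              2 ^ suc μ * (2 * (suc m * (m ^ m * (r * 2 ^ E)))) * suc m ^ suc m
              ≤ 2 ^ (μ + 2 + 2 * ℓ + 2 * (ℓ * suc m) + E)
power-bound μ ℓ E {m} {r} 1≤m n≤ r≤m = begin
  2 ^ suc μ * (2 * (n * (m ^ m * (r * 2 ^ E)))) * n ^ n
    ≤⟨ ℕ.*-mono-≤ (ℕ.*-monoʳ-≤ (2 ^ suc μ) (ℕ.*-monoʳ-≤ 2 (ℕ.*-mono-≤ n≤ (ℕ.*-mono-≤ mᵐ≤
         (ℕ.*-monoˡ-≤ (2 ^ E) (ℕ.≤-trans r≤m (ℕ.≤-trans (ℕ.n≤1+n m) n≤))))))) nⁿ≤ ⟩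
  2 ^ suc μ * (2 * (L * (P * (L * 2 ^ E)))) * P
    ≡⟨ solve 4 (λ M L P E → con 2 :* M :* (con 2 :* (L :* (P :* (L :* E)))) :* P
                         := M :* con 4 :* (L :* L) :* (P :* P) :* E) refl (2 ^ μ) L P (2 ^ E) ⟩
  2 ^ μ * 4 * (L * L) * (P * P) * 2 ^ E
    ≡⟨ cong₂ (λ a b → 2 ^ μ * 4 * a * b * 2 ^ E) (square ℓ) (square (ℓ * n)) ⟩
  2 ^ μ * 2 ^ 2 * 2 ^ (2 * ℓ) * 2 ^ (2 * (ℓ * n)) * 2 ^ E
    ≡⟨ cong (λ a → a * 2 ^ (2 * ℓ) * 2 ^ (2 * (ℓ * n)) * 2 ^ E) (ℕ.^-distribˡ-+-* 2 μ 2) ⟨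
  2 ^ (μ + 2) * 2 ^ (2 * ℓ) * 2 ^ (2 * (ℓ * n)) * 2 ^ E
    ≡⟨ cong (λ a → a * 2 ^ (2 * (ℓ * n)) * 2 ^ E) (ℕ.^-distribˡ-+-* 2 (μ + 2) (2 * ℓ)) ⟨
  2 ^ (μ + 2 + 2 * ℓ) * 2 ^ (2 * (ℓ * n)) * 2 ^ E
    ≡⟨ cong (_* 2 ^ E) (ℕ.^-distribˡ-+-* 2 (μ + 2 + 2 * ℓ) (2 * (ℓ * n))) ⟨
  2 ^ (μ + 2 + 2 * ℓ + 2 * (ℓ * n)) * 2 ^ E
    ≡⟨ ℕ.^-distribˡ-+-* 2 (μ + 2 + 2 * ℓ + 2 * (ℓ * n)) E ⟨
  2 ^ (μ + 2 + 2 * ℓ + 2 * (ℓ * n) + E) ∎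
  where
  open ℕ.≤-Reasoning
  n = suc m
  L = 2 ^ ℓ
  P = 2 ^ (ℓ * n)

  nⁿ≤ : n ^ n ≤ P
  nⁿ≤ = ℕ.≤-trans (ℕ.^-monoˡ-≤ n n≤) (ℕ.≤-reflexive (ℕ.^-*-assoc 2 ℓ n))

  mᵐ≤ : m ^ m ≤ P
  mᵐ≤ = ℕ.≤-trans (ℕ.^-monoˡ-≤ m (ℕ.n≤1+n m)) (ℕ.≤-trans (ℕ.^-monoʳ-≤ n (ℕ.n≤1+n m)) nⁿ≤)

  square : ∀ e → 2 ^ e * 2 ^ e ≡ 2 ^ (2 * e)
  square e = trans (sym (ℕ.^-distribˡ-+-* 2 e e)) (cong (2 ^_) (cong (e +_) (sym (ℕ.+-identityʳ e))))

b̃-lower′ : ∀ n → 2 ^ (⌊ n /2⌋ * ⌈ n /2⌉) ≤ b̃ n * n ^ n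
b̃-lower′ n = subst (λ k → 2 ^ (⌊ n /2⌋ * ⌈ n /2⌉) ≤ b̃ k * k ^ k) (ℕ.⌊n/2⌋+⌈n/2⌉≡n n) (b̃-lower ⌊ n /2⌋ ⌈ n /2⌉)

-- After multiplication by `2 * M`, each of the two terms on the right of `ext` is at most `B * D`.
combine-bounds : ∀ {M b B D n A} .{{_ : NonZero D}} → b * D ≤ B * n + A * D → 2 * M * n ≤ D → 2 * M * A ≤ B → M * b ≤ B
combine-bounds {M} {b} {B} {D} {n} {A} ext Mn≤D MA≤B = ℕ.*-cancelˡ-≤ 2 (ℕ.*-cancelʳ-≤ _ _ D (begin
  2 * (M * b) * D                   ≡⟨ solve 3 (λ M b D → con 2 :* (M :* b) :* D := con 2 :* M :* (b :* D)) refl M b D ⟩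
  2 * M * (b * D)                   ≤⟨ ℕ.*-monoʳ-≤ (2 * M) ext ⟩
  2 * M * (B * n + A * D)           ≡⟨ solve 5 (λ M B n A D → con 2 :* M :* (B :* n :+ A :* D)
                                         := B :* (con 2 :* M :* n) :+ con 2 :* M :* A :* D) refl M B n A D ⟩
  B * (2 * M * n) + 2 * M * A * D   ≤⟨ ℕ.+-mono-≤ (ℕ.*-monoʳ-≤ B Mn≤D) (ℕ.*-monoˡ-≤ D MA≤B) ⟩
  B * D + B * D                     ≡⟨ solve 2 (λ B D → B :* D :+ B :* D := con 2 :* B :* D) refl B D ⟩
  2 * B * D                         ∎))
  where open ℕ.≤-Reasoning

module _ (μ ℓ m k s : ℕ) (1≤m : 1 ≤ m) (n≤2^ℓ : suc m ≤ 2 ^ ℓ) (2rk≤m : 2 * (suc (ℓ + μ) * k) ≤ m)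
         (m≡k+s : m ≡ k + s) (r≤m : suc (ℓ + μ) ≤ m)
         (exponent : μ + 2 + 2 * ℓ + 2 * (ℓ * suc m) + s * s / 4 ≤ ⌊ suc m /2⌋ * ⌈ suc m /2⌉) where
  private
    r′ r n E : ℕ
    r′ = ℓ + μ
    r = suc r′
    n = suc m
    E = s * s / 4

  -- Without one block, the two color classes have `s = m - k` vertices together, so their product
  -- is at most a quarter of the square of `s`.
  cells≤E : ∀ a c → m ≡ r * k + a + c → (r′ * k + a) * c ≤ E
  cells≤E a c m≡ = subst (λ s → (r′ * k + a) * c ≤ s * s / 4) (ℕ.+-cancelˡ-≡ k (r′ * k + a + c) s (trans assoc (trans (sym m≡) m≡k+s)))
                     (pq≤[p+q]²/4 (r′ * k + a) c)
    where
    assoc : k + (r′ * k + a + c) ≡ r * k + a + c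
    assoc = trans (sym (ℕ.+-assoc k (r′ * k + a) c)) (cong (_+ c) (sym (ℕ.+-assoc k (r′ * k) a)))

  normalForms : (h : Fin (b̃ m)) → NormalForm r k h
  normalForms = normalForm r k 2rk≤m

  ambiguousBound : ℕ
  ambiguousBound = Extensions.ambiguousBound r′ k E normalForms cells≤E

  extension-bound : b̃ m * 2 ^ r ≤ b̃ n * n + ambiguousBound * 2 ^ r
  extension-bound = Extensions.b̃-extension-bound r′ k E normalForms cells≤E

  -- Multiplied by `n ^ n`, the left side is at most a power of 2 by `power-bound`, whose exponent
  -- is at most that of `b̃-lower′`.
  few-ambiguous : 2 ^ suc μ * ambiguousBound ≤ b̃ n
  few-ambiguous = ℕ.*-cancelʳ-≤ (2 ^ suc μ * ambiguousBound) (b̃ n) (n ^ n) {{ℕ.m^n≢0 n n}} (ℕ.≤-trans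
    (power-bound μ ℓ E {m} {r} 1≤m n≤2^ℓ r≤m)
    (ℕ.≤-trans (ℕ.^-monoʳ-≤ 2 exponent) (b̃-lower′ n)))

  many-codewords : 2 ^ suc μ * n ≤ 2 ^ r
  many-codewords = ℕ.≤-trans (ℕ.*-monoʳ-≤ (2 ^ suc μ) n≤2^ℓ) (ℕ.≤-reflexive
    (trans (sym (ℕ.^-distribˡ-+-* 2 (suc μ) ℓ)) (cong (λ e → 2 ^ suc e) (ℕ.+-comm μ ℓ))))

  b̃-growth-at : 2 ^ μ * b̃ m ≤ b̃ n
  b̃-growth-at = combine-bounds {2 ^ μ} {b̃ m} {b̃ n} {2 ^ r} {n} {ambiguousBound} {{ℕ.m^n≢0 2 r}}
    extension-bound many-codewords few-ambiguous

-- With r = ℓ + μ + 1 there are 2 ^ r ≥ 2 ^ (μ + 1) * (m + 1) codewords.  The block size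
-- k = 24 r is what exponent-bound requires, and 48 r² ≤ m fits the r blocks into the major color.
b̃-growth : ∀ μ → ∃ λ N → ∀ m → N ≤ m → 2 ^ μ * b̃ m ≤ b̃ (suc m)
b̃-growth μ = 2 ^ (μ + 20) , λ m N≤m →
  let ℓ , n≤2^ℓ , 48r²≤m = exponential-beats-square 48 20 (s≤s (s≤s (s≤s z≤n))) (ℕ.≤ᵇ⇒≤ _ _ _) μ m N≤m
      r : ℕ
      r = suc (ℓ + μ)
      k = 24 * r
      2rk≤m : 2 * (r * k) ≤ m
      2rk≤m = ℕ.≤-trans (ℕ.≤-reflexive (solve 1 (λ r → con 2 :* (r :* (con 24 :* r)) := con 48 :* (r :* r)) refl r)) 48r²≤m
      r≤m : r ≤ m
      r≤m = ℕ.≤-trans (ℕ.≤-trans (ℕ.m≤m*n r r) (ℕ.m≤n*m (r * r) 48)) 48r²≤m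
      k≤m : k ≤ m
      k≤m = ℕ.≤-trans (ℕ.≤-trans (ℕ.m≤n*m k r) (ℕ.m≤n*m (r * k) 2)) 2rk≤m
      m≡k+s : m ≡ k + (m ∸ k)
      m≡k+s = sym (ℕ.m+[n∸m]≡n k≤m)
      1≤m : 1 ≤ m
      1≤m = ℕ.≤-trans (s≤s z≤n) r≤m
  in b̃-growth-at μ ℓ m k (m ∸ k) 1≤m n≤2^ℓ 2rk≤m m≡k+s r≤m (exponent-bound μ ℓ m (m ∸ k) 1≤m m≡k+s)

-- Passage to the limit

n<2^n : ∀ n → n < 2 ^ n
n<2^n zero    = s≤s z≤n
n<2^n (suc n) = ℕ.+-mono-≤ {1} (ℕ.^-monoʳ-≤ 2 {0} {n} z≤n) (ℕ.≤-trans (n<2^n n) (ℕ.≤-reflexive (sym (ℕ.+-identityʳ _))))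

-- Divided by `b * ℚ.↧ₙ ε`, the last hypothesis says that `1 - s / b` is below the reciprocal of the
-- denominator of `ε`, and a positive `ε` is at least that reciprocal.
ratio-close : ∀ s b .{{_ : NonZero b}} ε → 0ℚ ℚ.< ε → s ≤ b → ℚ.↧ₙ ε * b < b + s * ℚ.↧ₙ ε →
              ℚ.∣ ℤ.+ s ℚ./ b ℚ.- 1ℚ ∣ ℚ.< ε
ratio-close s b (mkℚ ℤ.+0 _ _) 0<ε with () ← ℤ.Positive.pos (ℚ.positive 0<ε)
ratio-close s b (mkℚ ℤ.-[1+ _ ] _ _) 0<ε with () ← ℤ.Positive.pos (ℚ.positive 0<ε)
ratio-close s b@(suc b-1) ε@(mkℚ ℤ.+[1+ p ] d _) _ s≤b lt = begin-strict
  ℚ.∣ q ℚ.- 1ℚ ∣            ≡⟨ cong ℚ.∣_∣ (⁻¹-anti-homo-// 1ℚ q) ⟨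
  ℚ.∣ ℚ.- (1ℚ ℚ.- q) ∣      ≡⟨ ℚ.∣-p∣≡∣p∣ (1ℚ ℚ.- q) ⟩
  ℚ.∣ 1ℚ ℚ.- q ∣            ≡⟨ ℚ.0≤p⇒∣p∣≡p 0≤1-q ⟩
  1ℚ ℚ.- q                  <⟨ ℚ.+-monoˡ-< (ℚ.- q) 1<ε+q ⟩
  (ε ℚ.+ q) ℚ.- q           ≡⟨ trans (ℚ.+-assoc ε q (ℚ.- q)) (trans (cong (ε ℚ.+_) (ℚ.+-inverseʳ q)) (ℚ.+-identityʳ ε)) ⟩
  ε                         ∎
  where
  open ℚ.≤-Reasoning
  open GroupProperties ℚ.+-0-group using (⁻¹-anti-homo-//)
  q = ℤ.+ s ℚ./ b

  toℚᵘ-q : ℚ.toℚᵘ q ℚᵘ.≃ mkℚᵘ (ℤ.+ s) b-1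
  toℚᵘ-q = ℚ.toℚᵘ-fromℚᵘ (mkℚᵘ (ℤ.+ s) b-1)

  q≤1 : q ℚ.≤ 1ℚ
  q≤1 = ℚ.toℚᵘ-cancel-≤ (ℚᵘ.≤-respˡ-≃ (ℚᵘ.≃-sym toℚᵘ-q)
    (*≤* (subst₂ ℤ._≤_ (sym (ℤ.*-identityʳ (ℤ.+ s))) (sym (ℤ.*-identityˡ (ℤ.+ b))) (ℤ.+≤+ s≤b))))

  0≤1-q : 0ℚ ℚ.≤ 1ℚ ℚ.- q
  0≤1-q = subst (ℚ._≤ 1ℚ ℚ.- q) (ℚ.+-inverseʳ q) (ℚ.+-monoˡ-≤ (ℚ.- q) q≤1)

  numerators : suc d * b < suc p * b + s * suc d
  numerators = ℕ.<-≤-trans lt (ℕ.+-monoˡ-≤ (s * suc d) (ℕ.m≤m+n b (p * b)))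

  1<ε+q : 1ℚ ℚ.< ε ℚ.+ q
  1<ε+q = ℚ.toℚᵘ-cancel-< (ℚᵘ.<-respʳ-≃
    (ℚᵘ.≃-sym (ℚᵘ.≃-trans (ℚ.toℚᵘ-homo-+ ε q) (ℚᵘ.+-congʳ (mkℚᵘ (ℤ.+ suc p) d) toℚᵘ-q)))
    (*<* (subst₂ ℤ._<_ (sym (ℤ.*-identityˡ (ℤ.+ (suc d * b))))
      (trans (cong₂ ℤ._+_ (ℤ.pos-* (suc p) b) (ℤ.pos-* s (suc d))) (sym (ℤ.*-identityʳ _)))
      (ℤ.+<+ numerators))))

theorem3p10 : s̃ ∼ b̃
-- The estimates compare `m` with `suc m`, hence the threshold `suc N`.
theorem3p10 ε 0<ε = suc N , λ { (suc m) (s≤s N≤m) →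
    ratio-close (s̃ (suc m)) (b̃ (suc m)) ε 0<ε (s̃≤b̃ (suc m)) (close m N≤m) }
  where
  D = ℚ.↧ₙ ε
  -- Growth by `2 ^ D`, which exceeds `D`, gives `D * b̃ m < b̃ (suc m)`, strictly because `b̃ m` is
  -- nonzero.
  N = proj₁ (b̃-growth D)

  close : ∀ m → N ≤ m → D * b̃ (suc m) < b̃ (suc m) + s̃ (suc m) * D
  close m N≤m = begin-strict
    D * b̃ (suc m)                  ≤⟨ ℕ.*-monoʳ-≤ D (b̃-suc≤ m) ⟩
    D * (s̃ (suc m) + b̃ m)         ≡⟨ solve 3 (λ D s b → D :* (s :+ b) := D :* b :+ s :* D) refl D (s̃ (suc m)) (b̃ m) ⟩
    D * b̃ m + s̃ (suc m) * D       <⟨ ℕ.+-monoˡ-< (s̃ (suc m) * D) (ℕ.*-monoˡ-< (b̃ m) {{b̃-nonZero {m}}} (n<2^n D)) ⟩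
    2 ^ D * b̃ m + s̃ (suc m) * D   ≤⟨ ℕ.+-monoˡ-≤ (s̃ (suc m) * D) (proj₂ (b̃-growth D) m N≤m) ⟩
    b̃ (suc m) + s̃ (suc m) * D     ∎
    where open ℕ.≤-Reasoning
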